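{- Let $\mathsf H_{20}$ be the 20-vertex, 12-hyperedge hypergraph defined in the context. Set $$C=\frac{49-5\sqrt{69}}{26},\quad s=\sqrt C,\quad N=1+C,\quad r=\sqrt N,$$ $$\eta=\frac{5+12\mathrm i}{13},\qquad \zeta=\frac{14+6\sqrt{69}}{65}+\mathrm i\,\frac{4\sqrt{69}-21}{65},$$ $$(\mu_0,\ldots,\mu_7)=(-1,\eta,1,-\eta,-1,\eta,1,-\eta),$$ $$(\tau_0,\ldots,\tau_7)=(1,\zeta,-\mathrm i,-\mathrm i\zeta,-1,-\zeta,\mathrm i,\mathrm i\zeta).$$ Assign to the vertices of $\mathsf H_{20}$ the following vectors in $\mathbb C^3$ (denoted by the same symbols as the vertices): $$a_1=(s,1,0),\quad a_2=(s,-1,0),\quad b_1=(s,\eta,0),\quad b_2=(s,-\eta,0),$$ $$v_j=(1,\,s\mu_j,\,r\tau_j),\qquad j=0,\ldots,7,$$ and, for $j=0,\ldots,7$ with indices modulo $8$, $v_{j,j+1}=\overline{v_j\times v_{j+1}}$ (complex conjugate of the bilinear cross product), i.e. $$v_{j,j+1}=\bigl(sr(\bar\mu_j\bar\tau_{j+1}-\bar\tau_j\bar\mu_{j+1}),\ r(\bar\tau_j-\bar\tau_{j+1}),\ s(\bar\mu_{j+1}-\bar\mu_j)\bigr).$$ Then this assignment is a faithful orthogonal representation of $\mathsf H_{20}$ in $\mathbb C^3$.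
   Context: Inner product: $\langle x,y\rangle=\sum_{k}\overline{x_k}\,y_k$. Faithful orthogonal representation: let $\mathsf H=(V,\mathcal E)$ be a three-uniform hypergraph, $\mathbb F\in\{\mathbb R,\mathbb C\}$ and $d\ge 3$. A faithful orthogonal representation of $\mathsf H$ in $\mathbb F^d$ assigns to every $v\in V$ a nonzero vector $x_v\in\mathbb F^d$ such that (1) distinct vertices determine distinct rays (one-dimensional subspaces), and (2) for distinct $u,v\in V$, $\langle x_u,x_v\rangle=0$ if and only if $u$ and $v$ belong to a common hyperedge. The hypergraph $\mathsf H_{20}$: it has 20 vertices, namely $v_0,\ldots,v_7$ (midpoints), $v_{01},v_{12},v_{23},v_{34},v_{45},v_{56},v_{67},v_{70}$ (corners; also written $v_{j,j+1}$ with indices modulo $8$), and $a_1,a_2,b_1,b_2$. It has 12 hyperedges: $E_j=\{v_{j-1,j},\,v_j,\,v_{j,j+1}\}$ for $j=0,\ldots,7$ (indices modulo $8$), and $D_0=\{v_0,a_1,v_4\}$, $D_2=\{v_2,a_2,v_6\}$, $D_1=\{v_1,b_2,v_5\}$, $D_3=\{v_3,b_1,v_7\}$. -}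

module Defs where

open import Data.Bool.Base using (if_then_else_)
open import Data.Fin.Base using (Fin; zero; suc; toℕ)
open import Data.Fin.Patterns
open import Data.Fin.Properties using (all?)
import Data.Fin.Properties as Fin
open import Data.Integer.Base using (+_; +≤+)
import Data.Integer.Base as ℤ
import Data.Integer.Properties as ℤ
open import Data.Nat.Base using (ℕ; zero; suc; NonZero)
import Data.Nat.Base as ℕ
import Data.Nat.Properties as ℕ
open import Data.Nat.DivMod using (_mod_)
open import Data.Product.Base using (Σ-syntax; ∃-syntax; _×_; _,_)
open import Data.Rational.Base using (ℚ; mkℚ; 0ℚ; 1ℚ; ½; ↥_; _/_; ∣_∣; 1/_; Positive; positive; nonNegative)
import Data.Rational.Base as ℚ
import Data.Rational.Properties as ℚ
open import Data.Rational.Solver using (module +-*-Solver)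
import Data.Rational.Unnormalised.Base as ℚᵘ
import Data.Rational.Unnormalised.Properties as ℚᵘ
open import Data.Sum.Base using (_⊎_; inj₁; inj₂; [_,_]′)
open import Data.Vec.Functional using (Vector; []; _∷_; foldr; zipWith)
open import Function.Base using (_∘_)
open import Function.Bundles using (_⇔_)
open import Function.Definitions using (Injective)
open import Relation.Binary.PropositionalEquality
  using (_≡_; _≢_; refl; sym; trans; cong; cong₂; subst; subst₂)
open import Relation.Nullary using (¬_; Dec; yes; no; does)
open import Relation.Nullary.Negation using (contradiction)
open import Relation.Nullary.Decidable using (from-yes; _→-dec_)

module ℚ-lemmas where
  open Data.Rational.Base using (_+_; _*_; _-_; -_; _≤_; _<_)
  open +-*-Solver using (solve; _:=_; _:+_; _:*_; _:-_; :-_; con)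
  open ℚ.≤-Reasoning

  ∣∣< : ∀ {x ε} → x < ε → - x < ε → ∣ x ∣ < ε
  ∣∣< {x} x<ε -x<ε with ℚ.∣p∣≡p∨∣p∣≡-p x
  ... | inj₁ eq = subst (_< _) (sym eq) x<ε
  ... | inj₂ eq = subst (_< _) (sym eq) -x<ε

  ≤∣∣ : ∀ x → x ≤ ∣ x ∣
  ≤∣∣ x with ℚ.≤-total 0ℚ x
  ... | inj₁ 0≤x = ℚ.≤-reflexive (sym (ℚ.0≤p⇒∣p∣≡p 0≤x))
  ... | inj₂ x≤0 = ℚ.≤-trans x≤0 (ℚ.0≤∣p∣ x)

  ∣-∣-comm : ∀ x y → ∣ x - y ∣ ≡ ∣ y - x ∣
  ∣-∣-comm x y = trans (sym (ℚ.∣-p∣≡∣p∣ (x - y)))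
    (cong ∣_∣ (solve 2 (λ x y → :- (x :- y) := y :- x) refl x y))

  half-pos : ∀ {ε} → 0ℚ < ε → 0ℚ < ½ * ε
  half-pos {ε} 0<ε = subst (_< ½ * ε) (ℚ.*-zeroʳ ½) (ℚ.*-monoʳ-<-pos ½ {0ℚ} {ε} 0<ε)

  half+half : ∀ ε → ½ * ε + ½ * ε ≡ ε
  half+half = solve 1 (λ ε → con ½ :* ε :+ con ½ :* ε := ε) refl

  *-pos : ∀ {x y} → 0ℚ < x → 0ℚ < y → 0ℚ < x * y
  *-pos {x} {y} 0<x 0<y = ℚ.positive⁻¹ (x * y)
    {{ℚ.pos*pos⇒pos x {{positive 0<x}} y {{positive 0<y}}}}

  *-nonNeg : ∀ {x y} → 0ℚ ≤ x → 0ℚ ≤ y → 0ℚ ≤ x * y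
  *-nonNeg {x} {y} 0≤x 0≤y = ℚ.nonNegative⁻¹ (x * y)
    {{ℚ.nonNeg*nonNeg⇒nonNeg x {{nonNegative 0≤x}} y {{nonNegative 0≤y}}}}

  *-mono-≤ : ∀ {w x y z} → 0ℚ ≤ y → 0ℚ ≤ w → w ≤ x → y ≤ z → w * y ≤ x * z
  *-mono-≤ {w} {x} {y} {z} 0≤y 0≤w w≤x y≤z = ℚ.≤-trans
    (ℚ.*-monoʳ-≤-nonNeg y {{nonNegative 0≤y}} w≤x)
    (ℚ.*-monoˡ-≤-nonNeg x {{nonNegative (ℚ.≤-trans 0≤w w≤x)}} y≤z)

  square-mono : ∀ {x y} → 0ℚ ≤ x → x ≤ y → x * x ≤ y * y
  square-mono 0≤x x≤y = *-mono-≤ 0≤x 0≤x x≤y x≤y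

  +-nonNeg : ∀ {x y} → 0ℚ ≤ x → 0ℚ ≤ y → 0ℚ ≤ x + y
  +-nonNeg 0≤x 0≤y = ℚ.+-mono-≤ 0≤x 0≤y

  ≤-+ʳ : ∀ {x y} → 0ℚ ≤ y → x ≤ x + y
  ≤-+ʳ {x} {y} 0≤y = subst (_≤ x + y) (ℚ.+-identityʳ x) (ℚ.+-monoʳ-≤ x 0≤y)

  ∣*∣< : ∀ {a b A δ} → 0ℚ < A → ∣ a ∣ ≤ A → ∣ b ∣ < δ → ∣ a * b ∣ < A * δ
  ∣*∣< {a} {b} {A} {δ} 0<A ∣a∣≤A ∣b∣<δ = begin-strict
    ∣ a * b ∣        ≡⟨ ℚ.∣p*q∣≡∣p∣*∣q∣ a b ⟩
    ∣ a ∣ * ∣ b ∣    ≤⟨ ℚ.*-monoʳ-≤-nonNeg ∣ b ∣ {{ℚ.∣-∣-nonNeg b}} {∣ a ∣} {A} ∣a∣≤A ⟩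
    A * ∣ b ∣        <⟨ ℚ.*-monoʳ-<-pos A {{positive 0<A}} {∣ b ∣} {δ} ∣b∣<δ ⟩
    A * δ            ∎

  product-close : ∀ {a b c d A B δ δ′} → 0ℚ < A → 0ℚ < B → ∣ a ∣ ≤ A → ∣ d ∣ ≤ B →
                  ∣ b - d ∣ < δ → ∣ a - c ∣ < δ′ → ∣ a * b - c * d ∣ < A * δ + B * δ′
  product-close {a} {b} {c} {d} {A} {B} {δ} {δ′} 0<A 0<B ∣a∣≤A ∣d∣≤B near near′ = begin-strict
    ∣ a * b - c * d ∣
      ≡⟨ cong ∣_∣ (solve 4 (λ a b c d → a :* b :- c :* d := a :* (b :- d) :+ d :* (a :- c))
           refl a b c d) ⟩
    ∣ a * (b - d) + d * (a - c) ∣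
      ≤⟨ ℚ.∣p+q∣≤∣p∣+∣q∣ (a * (b - d)) (d * (a - c)) ⟩
    ∣ a * (b - d) ∣ + ∣ d * (a - c) ∣
      <⟨ ℚ.+-mono-< {∣ a * (b - d) ∣} {A * δ} {∣ d * (a - c) ∣} {B * δ′}
           (∣*∣< 0<A ∣a∣≤A near) (∣*∣< 0<B ∣d∣≤B near′) ⟩
    A * δ + B * δ′ ∎

  scale-below : ∀ {B ε} → 0ℚ < B → 0ℚ < ε → Σ[ δ ∈ ℚ ] 0ℚ < δ × B * δ ≡ ε
  scale-below {B} {ε} 0<B 0<ε = 1/B * ε , *-pos 0<1/B 0<ε , eq
    where
    instance
      B-pos : Positive B
      B-pos = positive 0<B
      B-nz : ℚ.NonZero B
      B-nz = ℚ.pos⇒nonZero B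
    1/B = 1/ B
    0<1/B : 0ℚ < 1/B
    0<1/B = ℚ.positive⁻¹ 1/B {{ℚ.1/pos⇒pos B}}
    eq : B * (1/B * ε) ≡ ε
    eq = trans (sym (ℚ.*-assoc B 1/B ε))
      (trans (cong (_* ε) (ℚ.*-inverseʳ B)) (ℚ.*-identityˡ ε))

  /-nonNeg : ∀ m k .{{_ : NonZero k}} → 0ℚ ≤ + m / k
  /-nonNeg m k = ℚ.nonNegative⁻¹ (+ m / k) {{ℚ.normalize-nonNeg m k}}

  /-mono : ∀ m k m′ k′ → m ℕ.* suc k′ ℕ.≤ m′ ℕ.* suc k → + m / suc k ≤ + m′ / suc k′
  /-mono m k m′ k′ le = ℚ.toℚᵘ-cancel-≤ (ℚᵘ.≤-trans
    (ℚᵘ.≤-reflexive (ℚ.toℚᵘ-fromℚᵘ (ℚᵘ.mkℚᵘ (+ m) k)))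
    (ℚᵘ.≤-trans (ℚᵘ.*≤* (subst₂ ℤ._≤_ (ℤ.pos-* m (suc k′)) (ℤ.pos-* m′ (suc k)) (+≤+ le)))
      (ℚᵘ.≤-reflexive (ℚᵘ.≃-sym (ℚ.toℚᵘ-fromℚᵘ (ℚᵘ.mkℚᵘ (+ m′) k′))))))

  /-suc : ∀ m k → + suc m / suc k ≡ + m / suc k + + 1 / suc k
  /-suc m k = ℚ.toℚᵘ-injective (ℚᵘ.≃-trans
    (ℚ.toℚᵘ-fromℚᵘ (ℚᵘ.mkℚᵘ (+ suc m) k)) (ℚᵘ.≃-trans (ℚᵘ.*≡* eq) (ℚᵘ.≃-sym
    (ℚᵘ.≃-trans (ℚ.toℚᵘ-homo-+ (+ m / suc k) (+ 1 / suc k))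
      (ℚᵘ.+-cong (ℚ.toℚᵘ-fromℚᵘ (ℚᵘ.mkℚᵘ (+ m) k)) (ℚ.toℚᵘ-fromℚᵘ (ℚᵘ.mkℚᵘ (+ 1) k)))))))
    where
    eq : + suc m ℤ.* (+ suc k ℤ.* + suc k) ≡ (+ m ℤ.* + suc k ℤ.+ + 1 ℤ.* + suc k) ℤ.* + suc k
    eq = trans (sym (ℤ.*-assoc (+ suc m) (+ suc k) (+ suc k)))
      (cong (ℤ._* + suc k) (trans (cong (ℤ._* + suc k) (ℤ.+-comm (+ 1) (+ m)))
        (ℤ.*-distribʳ-+ (+ suc k) (+ m) (+ 1))))

  ≤numerator : ∀ q → q ≤ + ℤ.∣ ↥ q ∣ / 1
  ≤numerator q@(mkℚ (+ n) d _) = subst (_≤ _) (ℚ.↥p/↧p≡p q)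
    (/-mono n d n 0 (ℕ.*-monoʳ-≤ n (ℕ.s≤s ℕ.z≤n)))
  ≤numerator q@(mkℚ (ℤ.-[1+ n ]) _ _) = ℚ.≤-trans
    (ℚ.<⇒≤ (ℚ.negative⁻¹ q)) (/-nonNeg (suc n) 1)

  archimedean : ∀ {ε} → 0ℚ < ε → Σ[ N ∈ ℕ ] (∀ n → N ℕ.≤ n → + 1 / suc n ≤ ε)
  archimedean {mkℚ (+ zero) d c} 0<ε = contradiction (ℚ.drop-*<* 0<ε)
    (ℤ.<-irrefl refl)
  archimedean {q@(mkℚ (+ suc m) d c)} 0<ε = d , λ n d≤n → subst (_ ≤_) (ℚ.↥p/↧p≡p q)
    (/-mono 1 n (suc m) d (ℕ.≤-trans (subst (ℕ._≤ suc n) (sym (ℕ.*-identityˡ (suc d))) (ℕ.s≤s d≤n))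
      (ℕ.m≤m+n (suc n) (m ℕ.* suc n))))
  archimedean {mkℚ (ℤ.-[1+ m ]) d c} 0<ε = contradiction (ℚ.drop-*<* 0<ε) λ ()

open ℚ-lemmas

IsCauchy : (ℕ → ℚ) → Set
IsCauchy x = ∀ ε → 0ℚ ℚ.< ε →
  Σ[ N ∈ ℕ ] (∀ m n → N ℕ.≤ m → N ℕ.≤ n → ∣ x m ℚ.- x n ∣ ℚ.< ε)

-- A real number is given by a Cauchy sequence; equality of reals is _≃ᴿ_, not _≡_.
record ℝ : Set where
  no-eta-equality
  constructor mkℝ
  field
    seq    : ℕ → ℚ
    cauchy : IsCauchy seq
open ℝ public

infix 4 _≃ᴿ_ 0≤ᴿ_

_≃ᴿ_ : ℝ → ℝ → Set
x ≃ᴿ y = ∀ ε → 0ℚ ℚ.< ε → Σ[ N ∈ ℕ ] (∀ n → N ℕ.≤ n → ∣ seq x n ℚ.- seq y n ∣ ℚ.< ε)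

-- The limit is nonnegative, although the terms need not be.
0≤ᴿ_ : ℝ → Set
0≤ᴿ x = ∀ ε → 0ℚ ℚ.< ε → Σ[ N ∈ ℕ ] (∀ n → N ℕ.≤ n → ℚ.- ε ℚ.< seq x n)

module Cauchy where
  open Data.Rational.Base using (_+_; _*_; _-_; -_; _≤_; _<_)
  open +-*-Solver using (solve; _:=_; _:+_; _:*_; _:-_; :-_; con)
  open ℚ.≤-Reasoning

  bound : ∀ x → IsCauchy x → Σ[ B ∈ ℚ ] 0ℚ < B × Σ[ N ∈ ℕ ] (∀ n → N ℕ.≤ n → ∣ x n ∣ ≤ B)
  bound x cx with cx 1ℚ (ℚ.positive⁻¹ 1ℚ)
  ... | N , near = ∣ x N ∣ + 1ℚ , ℚ.+-mono-≤-< (ℚ.0≤∣p∣ (x N)) (ℚ.positive⁻¹ 1ℚ) , N , λ n N≤n → begin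
    ∣ x n ∣                     ≡⟨ cong ∣_∣ (solve 2 (λ a b → a := b :+ (a :- b)) refl (x n) (x N)) ⟩
    ∣ x N + (x n - x N) ∣       ≤⟨ ℚ.∣p+q∣≤∣p∣+∣q∣ (x N) (x n - x N) ⟩
    ∣ x N ∣ + ∣ x n - x N ∣     ≤⟨ ℚ.+-monoʳ-≤ ∣ x N ∣ (ℚ.<⇒≤ (near n N N≤n ℕ.≤-refl)) ⟩
    ∣ x N ∣ + 1ℚ                ∎

  const : ∀ q → IsCauchy (λ _ → q)
  const q ε 0<ε = 0 , λ _ _ _ _ → subst (λ z → ∣ z ∣ < ε) (sym (ℚ.+-inverseʳ q)) 0<ε

  add : ∀ x y → IsCauchy x → IsCauchy y → IsCauchy (λ n → x n + y n)
  add x y cx cy ε 0<ε with cx (½ * ε) (half-pos 0<ε) | cy (½ * ε) (half-pos 0<ε)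
  ... | M , p | N , q = M ℕ.⊔ N , λ m n m≥ n≥ → begin-strict
    ∣ (x m + y m) - (x n + y n) ∣
      ≡⟨ cong ∣_∣ (solve 4 (λ a b c d → (a :+ b) :- (c :+ d) := (a :- c) :+ (b :- d)) refl
           (x m) (y m) (x n) (y n)) ⟩
    ∣ (x m - x n) + (y m - y n) ∣
      ≤⟨ ℚ.∣p+q∣≤∣p∣+∣q∣ (x m - x n) (y m - y n) ⟩
    ∣ x m - x n ∣ + ∣ y m - y n ∣
      <⟨ ℚ.+-mono-< (p m n (ℕ.m⊔n≤o⇒m≤o M N m≥) (ℕ.m⊔n≤o⇒m≤o M N n≥))
                    (q m n (ℕ.m⊔n≤o⇒n≤o M N m≥) (ℕ.m⊔n≤o⇒n≤o M N n≥)) ⟩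
    ½ * ε + ½ * ε
      ≡⟨ half+half ε ⟩
    ε ∎

  neg : ∀ x → IsCauchy x → IsCauchy (λ n → - x n)
  neg x cx ε 0<ε with cx ε 0<ε
  ... | N , p = N , λ m n m≥ n≥ → subst (_< ε)
    (trans (∣-∣-comm (x m) (x n))
      (cong ∣_∣ (solve 2 (λ a b → b :- a := :- a :- :- b) refl (x m) (x n))))
    (p m n m≥ n≥)

  mul : ∀ x y → IsCauchy x → IsCauchy y → IsCauchy (λ n → x n * y n)
  mul x y cx cy ε 0<ε =
    let
      A , 0<A , K , ∣x∣≤A = bound x cx
      B , 0<B , L , ∣y∣≤B = bound y cy
      δ , 0<δ , Aδ   = scale-below 0<A (half-pos 0<ε)
      δ′ , 0<δ′ , Bδ′ = scale-below 0<B (half-pos 0<ε)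
      M , near-y = cy δ 0<δ
      N , near-x = cx δ′ 0<δ′
    in (K ℕ.⊔ L) ℕ.⊔ (M ℕ.⊔ N) , λ m n m≥ n≥ →
    let
      m≥K = ℕ.m⊔n≤o⇒m≤o K L (ℕ.m⊔n≤o⇒m≤o (K ℕ.⊔ L) (M ℕ.⊔ N) m≥)
      n≥L = ℕ.m⊔n≤o⇒n≤o K L (ℕ.m⊔n≤o⇒m≤o (K ℕ.⊔ L) (M ℕ.⊔ N) n≥)
      m≥′ = ℕ.m⊔n≤o⇒n≤o (K ℕ.⊔ L) (M ℕ.⊔ N) m≥
      n≥′ = ℕ.m⊔n≤o⇒n≤o (K ℕ.⊔ L) (M ℕ.⊔ N) n≥
    in subst (∣ x m * y m - x n * y n ∣ <_) (trans (cong₂ _+_ Aδ Bδ′) (half+half ε))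
         (product-close {x m} {y m} {x n} {y n} {A} {B} {δ} {δ′} 0<A 0<B
           (∣x∣≤A m m≥K) (∣y∣≤B n n≥L)
           (near-y m n (ℕ.m⊔n≤o⇒m≤o M N m≥′) (ℕ.m⊔n≤o⇒m≤o M N n≥′))
           (near-x m n (ℕ.m⊔n≤o⇒n≤o M N m≥′) (ℕ.m⊔n≤o⇒n≤o M N n≥′)))

infixl 6 _+ᴿ_ _-ᴿ_
infixl 7 _*ᴿ_
infix  8 -ᴿ_

fromℚ : ℚ → ℝ
seq    (fromℚ q) _ = q
cauchy (fromℚ q) = Cauchy.const q

_+ᴿ_ _*ᴿ_ : ℝ → ℝ → ℝ
seq    (x +ᴿ y) n = seq x n ℚ.+ seq y n
cauchy (x +ᴿ y) = Cauchy.add (seq x) (seq y) (cauchy x) (cauchy y)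

seq    (x *ᴿ y) n = seq x n ℚ.* seq y n
cauchy (x *ᴿ y) = Cauchy.mul (seq x) (seq y) (cauchy x) (cauchy y)

-ᴿ_ : ℝ → ℝ
seq    (-ᴿ x) n = ℚ.- seq x n
cauchy (-ᴿ x) = Cauchy.neg (seq x) (cauchy x)

_-ᴿ_ : ℝ → ℝ → ℝ
x -ᴿ y = x +ᴿ -ᴿ y

ifSquareBelow : ℚ → ℚ → ℚ → ℚ
ifSquareBelow q x y = if does (x ℚ.* x ℚ.≤? q) then x else y

-- The greatest i / (n + 1) with i ≤ k whose square is at most q (0 if there is none).
rootUpTo : ℕ → ℚ → ℕ → ℚ
rootUpTo zero    q n = 0ℚ
rootUpTo (suc k) q n = ifSquareBelow q (+ suc k / suc n) (rootUpTo k q n)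

-- Since q < (1 + ∣ ↥ q ∣)², this is √q rounded down to a multiple of 1 / (n + 1);
-- for negative q it is 0.
root : ℚ → ℕ → ℚ
root q n = rootUpTo (suc ℤ.∣ ↥ q ∣ ℕ.* suc n) q n

module Root where
  open Data.Rational.Base using (_+_; _*_; _-_; -_; _≤_; _<_)
  open +-*-Solver using (solve; _:=_; _:+_; _:*_; _:-_; :-_; con)
  open ℚ.≤-Reasoning

  if-elim : ∀ {A : Set} (P : ℚ → Set) (d : Dec A) {x y} → (A → P x) → (¬ A → P y) →
            P (if does d then x else y)
  if-elim P (yes a) f g = f a
  if-elim P (no ¬a) f g = g ¬a

  split : ∀ (P : ℚ → Set) q x y → (x * x ≤ q → P x) → (q < x * x → P y) →
          P (ifSquareBelow q x y)
  split P q x y below above = if-elim P (x * x ℚ.≤? q) below (above ∘ ℚ.≰⇒>)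

  nonNeg : ∀ k q n → 0ℚ ≤ rootUpTo k q n
  nonNeg zero    q n = ℚ.≤-refl
  nonNeg (suc k) q n = split (0ℚ ≤_) q (+ suc k / suc n) (rootUpTo k q n)
    (λ _ → /-nonNeg (suc k) (suc n)) (λ _ → nonNeg k q n)

  lower : ∀ k q n → rootUpTo k q n ≡ 0ℚ ⊎ rootUpTo k q n * rootUpTo k q n ≤ q
  lower zero    q n = inj₁ refl
  lower (suc k) q n = split (λ z → z ≡ 0ℚ ⊎ z * z ≤ q) q (+ suc k / suc n) (rootUpTo k q n)
    inj₂ (λ _ → lower k q n)

  upperUpTo : ∀ k q n → q < (+ suc k / suc n) * (+ suc k / suc n) →
              let x = rootUpTo k q n + + 1 / suc n in q < x * x
  upperUpTo zero q n h = subst (λ z → q < z * z) (sym (ℚ.+-identityˡ (+ 1 / suc n))) h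
  upperUpTo (suc k) q n h =
    split (λ z → q < (z + + 1 / suc n) * (z + + 1 / suc n)) q (+ suc k / suc n) (rootUpTo k q n)
      (λ _ → subst (λ z → q < z * z) (/-suc (suc k) n) h) (upperUpTo k q n)

  upper : ∀ q n → let x = root q n + + 1 / suc n in q < x * x
  upper q n = upperUpTo K q n (begin-strict
    q                                  ≤⟨ ≤numerator q ⟩
    + a / 1                            <⟨ subst (_< a′ + 1ℚ) (ℚ.+-identityʳ a′)
                                            (ℚ.+-monoʳ-< a′ (ℚ.positive⁻¹ 1ℚ)) ⟩
    a′ + 1ℚ                            ≡⟨ sym (/-suc a 0) ⟩
    z                                  ≡⟨ sym (ℚ.*-identityʳ z) ⟩
    z * 1ℚ                             ≤⟨ ℚ.*-monoˡ-≤-nonNeg z {{nonNegative 0≤z}} 1≤z ⟩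
    z * z                              ≤⟨ square-mono 0≤z z≤y ⟩
    y * y                              ∎)
    where
    a = ℤ.∣ ↥ q ∣
    a′ = + a / 1
    K = suc a ℕ.* suc n
    z = + suc a / 1
    y = + suc K / suc n
    0≤z : 0ℚ ≤ z
    0≤z = /-nonNeg (suc a) 1
    1≤z : 1ℚ ≤ z
    1≤z = /-mono 1 0 (suc a) 0 (ℕ.s≤s ℕ.z≤n)
    z≤y : z ≤ y
    z≤y = /-mono (suc a) 0 (suc K) n (subst (K ℕ.≤_) (sym (ℕ.*-identityʳ (suc K))) (ℕ.n≤1+n K))

  close : ∀ {a b p q h h′} → 0ℚ ≤ b → a ≡ 0ℚ ⊎ a * a ≤ p → q < (b + h′) * (b + h′) →
          0ℚ < h → 0ℚ ≤ h′ → h′ ≤ h → p - q < h * h → a - b < h + h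
  close {a} {b} {p} {q} {h} {h′} 0≤b low up 0<h 0≤h′ h′≤h p-q<h² with a - b ℚ.<? h + h
  ... | yes a-b<2h = a-b<2h
  ... | no  a-b≮2h = contradiction p<p (ℚ.<-irrefl refl)
    where
    0≤h = ℚ.<⇒≤ 0<h
    0≤b+h = +-nonNeg 0≤b 0≤h
    b+2h≤a : (b + h) + h ≤ a
    b+2h≤a = begin
      (b + h) + h   ≡⟨ solve 2 (λ b h → (b :+ h) :+ h := b :+ (h :+ h)) refl b h ⟩
      b + (h + h)   ≤⟨ ℚ.+-monoʳ-≤ b (ℚ.≮⇒≥ a-b≮2h) ⟩
      b + (a - b)   ≡⟨ solve 2 (λ a b → b :+ (a :- b) := a) refl a b ⟩
      a             ∎
    0<a : 0ℚ < a
    0<a = ℚ.<-≤-trans (ℚ.+-mono-≤-< 0≤b+h 0<h) b+2h≤a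
    a²≤p : a * a ≤ p
    a²≤p = [ (λ a≡0 → contradiction (sym a≡0) (ℚ.<⇒≢ 0<a)) , (λ le → le) ]′ low
    p<p : p < p
    p<p = begin-strict
      p
        ≡⟨ solve 2 (λ p q → p := q :+ (p :- q)) refl p q ⟩
      q + (p - q)
        <⟨ ℚ.+-mono-< up p-q<h² ⟩
      (b + h′) * (b + h′) + h * h
        ≤⟨ ℚ.+-monoˡ-≤ (h * h) (square-mono (+-nonNeg 0≤b 0≤h′) (ℚ.+-monoʳ-≤ b h′≤h)) ⟩
      (b + h) * (b + h) + h * h
        ≤⟨ ≤-+ʳ (+-nonNeg (*-nonNeg 0≤b+h 0≤h) (*-nonNeg 0≤b+h 0≤h)) ⟩
      ((b + h) * (b + h) + h * h) + ((b + h) * h + (b + h) * h)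
        ≡⟨ solve 2 (λ c h → (c :* c :+ h :* h) :+ (c :* h :+ c :* h) := (c :+ h) :* (c :+ h))
             refl (b + h) h ⟩
      ((b + h) + h) * ((b + h) + h)
        ≤⟨ square-mono (+-nonNeg 0≤b+h 0≤h) b+2h≤a ⟩
      a * a
        ≤⟨ a²≤p ⟩
      p ∎

  square-above : ∀ q n {ε} → 0ℚ < ε → - ε < q → root q n * root q n - q < ε
  square-above q n {ε} 0<ε -ε<q =
    [ (λ r≡0 → begin-strict
        r * r - q      ≡⟨ cong (λ z → z * z - q) r≡0 ⟩
        0ℚ * 0ℚ - q    ≡⟨ ℚ.+-identityˡ (- q) ⟩
        - q            <⟨ ℚ.neg-antimono-< { - ε} {q} -ε<q ⟩
        - (- ε)        ≡⟨ solve 1 (λ e → :- (:- e) := e) refl ε ⟩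
        ε              ∎)
    , (λ r²≤q → ℚ.≤-<-trans
        (subst (r * r - q ≤_) (ℚ.+-inverseʳ q) (ℚ.+-monoˡ-≤ (- q) r²≤q)) 0<ε)
    ]′ (lower (suc ℤ.∣ ↥ q ∣ ℕ.* suc n) q n)
    where r = root q n

  2B+1-pos : ∀ {B} → 0ℚ < B → 0ℚ < B + B + 1ℚ
  2B+1-pos {B} 0<B =
    ℚ.+-mono-< {0ℚ} {B + B} {0ℚ} {1ℚ} (ℚ.+-mono-< {0ℚ} {B} {0ℚ} {B} 0<B 0<B) (ℚ.positive⁻¹ 1ℚ)

  square-below : ∀ q n {B δ} → ∣ root q n ∣ ≤ B → + 1 / suc n ≤ δ →
                 - (root q n * root q n - q) < (B + B + 1ℚ) * δ
  square-below q n {B} {δ} ∣r∣≤B h≤δ = begin-strict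
    - (r * r - q)              ≡⟨ solve 2 (λ a b → :- (a :- b) := b :- a) refl (r * r) q ⟩
    q - r * r                  <⟨ ℚ.+-monoˡ-< (- (r * r)) (upper q n) ⟩
    (r + h) * (r + h) - r * r  ≡⟨ solve 2 (λ r h → (r :+ h) :* (r :+ h) :- r :* r :=
                                    (r :+ r :+ h) :* h) refl r h ⟩
    (r + r + h) * h            ≤⟨ *-mono-≤ 0≤h (+-nonNeg (+-nonNeg 0≤r 0≤r) 0≤h)
                                    (ℚ.+-mono-≤ (ℚ.+-mono-≤ r≤B r≤B) h≤1) h≤δ ⟩
    (B + B + 1ℚ) * δ           ∎
    where
    r = root q n
    h = + 1 / suc n
    0≤h : 0ℚ ≤ h
    0≤h = /-nonNeg 1 (suc n)
    h≤1 : h ≤ 1ℚ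
    h≤1 = /-mono 1 n 1 0 (ℕ.s≤s ℕ.z≤n)
    0≤r : 0ℚ ≤ r
    0≤r = nonNeg (suc ℤ.∣ ↥ q ∣ ℕ.* suc n) q n
    r≤B : r ≤ B
    r≤B = ℚ.≤-trans (≤∣∣ r) ∣r∣≤B

  square : ∀ (x : ℕ → ℚ) ε →
    Σ[ B ∈ ℚ ] 0ℚ < B × Σ[ K ∈ ℕ ] (∀ n → K ℕ.≤ n → ∣ root (x n) n ∣ ≤ B) →
    (∀ B → 0ℚ < B → Σ[ δ ∈ ℚ ] 0ℚ < δ × (B + B + 1ℚ) * δ ≡ ε) →
    0ℚ < ε → Σ[ M ∈ ℕ ] (∀ n → M ℕ.≤ n → - ε < x n) →
    Σ[ N ∈ ℕ ] (∀ n → N ℕ.≤ n → ∣ root (x n) n * root (x n) n - x n ∣ < ε)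
  square x ε (B , 0<B , K , ∣r∣≤B) scale 0<ε (M , lower-bound) =
    let
      δ , 0<δ , δ-eq = scale B 0<B
      L , small = archimedean 0<δ
    in K ℕ.⊔ (L ℕ.⊔ M) , λ n n≥ →
    let
      n≥K = ℕ.m⊔n≤o⇒m≤o K (L ℕ.⊔ M) n≥
      n≥′ = ℕ.m⊔n≤o⇒n≤o K (L ℕ.⊔ M) n≥
      r²-x = root (x n) n * root (x n) n - x n
    in ∣∣< {r²-x}
      (square-above (x n) n {ε} 0<ε (lower-bound n (ℕ.m⊔n≤o⇒n≤o L M n≥′)))
      (subst (- r²-x <_) δ-eq (square-below (x n) n {B} {δ}
        (∣r∣≤B n n≥K) (small n (ℕ.m⊔n≤o⇒m≤o L M n≥′))))

  half : ∀ ε p q m n → 0ℚ < ε → + 1 / suc n ≤ ½ * ε → ∣ p - q ∣ < ½ * ε * (½ * ε) →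
         root p m - root q n < ε
  half ε p q m n 0<ε small near = subst (root p m - root q n <_) (half+half ε)
    (close (nonNeg (suc ℤ.∣ ↥ q ∣ ℕ.* suc n) q n) (lower (suc ℤ.∣ ↥ p ∣ ℕ.* suc m) p m)
      (upper q n) (half-pos 0<ε) (/-nonNeg 1 (suc n)) small
      (ℚ.≤-<-trans (≤∣∣ (p - q)) near))

  isCauchy : ∀ x → IsCauchy x → IsCauchy (λ n → root (x n) n)
  isCauchy x cx ε 0<ε =
    let
      h = ½ * ε
      0<h = half-pos 0<ε
      M , near = cx (h * h) (*-pos 0<h 0<h)
      N , small = archimedean 0<h
    in M ℕ.⊔ N , λ m n m≥ n≥ →
      let
        m≥M = ℕ.m⊔n≤o⇒m≤o M N m≥
        n≥M = ℕ.m⊔n≤o⇒m≤o M N n≥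
      in ∣∣< {root (x m) m - root (x n) n}
        (half ε (x m) (x n) m n 0<ε (small n (ℕ.m⊔n≤o⇒n≤o M N n≥)) (near m n m≥M n≥M))
        (subst (_< ε) (solve 2 (λ a b → b :- a := :- (a :- b)) refl (root (x m) m) (root (x n) n))
          (half ε (x n) (x m) n m 0<ε (small m (ℕ.m⊔n≤o⇒n≤o M N m≥)) (near n m n≥M m≥M)))

infix 8 √_

√_ : ℝ → ℝ
seq    (√ x) n = root (seq x n) n
cauchy (√ x) = Root.isCauchy (seq x) (cauchy x)

√-nonNegative : ∀ x → 0≤ᴿ √ x
√-nonNegative x ε 0<ε = 0 , λ n _ → ℚ.<-≤-trans (ℚ.neg-antimono-< {0ℚ} {ε} 0<ε)
  (Root.nonNeg (suc ℤ.∣ ↥ seq x n ∣ ℕ.* suc n) (seq x n) n)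

√-square : ∀ x → 0≤ᴿ x → √ x *ᴿ √ x ≃ᴿ x
√-square x 0≤x ε 0<ε = Root.square (seq x) ε (Cauchy.bound (seq (√ x)) (cauchy (√ x)))
  (λ B 0<B → scale-below {B ℚ.+ B ℚ.+ 1ℚ} {ε} (Root.2B+1-pos 0<B) 0<ε) 0<ε (0≤x ε 0<ε)

infix  4 _≃_ _≋_
infixl 6 _+_ _-_
infixl 7 _*_ _·_
infix  8 -_
infix  5 _+i_

record ℂ : Set where
  no-eta-equality
  constructor _+i_
  field
    re im : ℝ
open ℂ public

_≃_ : ℂ → ℂ → Set
z ≃ w = re z ≃ᴿ re w × im z ≃ᴿ im w

fromℝ : ℝ → ℂ
fromℝ x = x +i fromℚ 0ℚ

0ℂ 1ℂ i : ℂ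
0ℂ = fromℝ (fromℚ 0ℚ)
1ℂ = fromℝ (fromℚ 1ℚ)
i  = fromℚ 0ℚ +i fromℚ 1ℚ

_+_ _*_ : ℂ → ℂ → ℂ
z + w = (re z +ᴿ re w) +i (im z +ᴿ im w)
z * w = (re z *ᴿ re w -ᴿ im z *ᴿ im w) +i (re z *ᴿ im w +ᴿ im z *ᴿ re w)

-_ conj : ℂ → ℂ
- z    = (-ᴿ re z) +i (-ᴿ im z)
conj z = re z +i (-ᴿ im z)

_-_ : ℂ → ℂ → ℂ
z - w = z + - w

_≋_ : ∀ {d} → Vector ℂ d → Vector ℂ d → Set
x ≋ y = ∀ k → x k ≃ y k

_·_ : ∀ {d} → ℂ → Vector ℂ d → Vector ℂ d
(c · x) k = c * x k

⟨_,_⟩ : ∀ {d} → Vector ℂ d → Vector ℂ d → ℂ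
⟨ x , y ⟩ = foldr _+_ 0ℂ (zipWith (λ a b → conj a * b) x y)

NonzeroVector : ∀ {d} → Vector ℂ d → Set
NonzeroVector x = ¬ x ≋ (λ _ → 0ℂ)

_∈Span_ : ∀ {d} → Vector ℂ d → Vector ℂ d → Set
y ∈Span x = ∃[ c ] y ≋ c · x

SameRay : ∀ {d} → Vector ℂ d → Vector ℂ d → Set
SameRay x y = ∀ z → z ∈Span x ⇔ z ∈Span y

cross : Vector ℂ 3 → Vector ℂ 3 → Vector ℂ 3
cross x y = (x 1F * y 2F - x 2F * y 1F)
          ∷ (x 2F * y 0F - x 0F * y 2F)
          ∷ (x 0F * y 1F - x 1F * y 0F)
          ∷ []

-- The hyperedges form a set of three-element subsets of V, indexed by E: each
-- hyperedge lists three different vertices, and different indices give different subsets.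
record ThreeUniformHypergraph : Set₁ where
  field
    V    : Set
    E    : Set
    edge : E → Vector V 3

  _∈_ : V → E → Set
  v ∈ e = ∃[ k ] edge e k ≡ v

  field
    edge-distinct : ∀ e → Injective _≡_ _≡_ (edge e)
    edge-set      : ∀ e f → (∀ v → v ∈ e ⇔ v ∈ f) → e ≡ f

  InCommonEdge : V → V → Set
  InCommonEdge u v = ∃[ e ] u ∈ e × v ∈ e

record IsFaithfulOrthogonalRepresentation
         (H : ThreeUniformHypergraph) {d : ℕ}
         (x : ThreeUniformHypergraph.V H → Vector ℂ d) : Set where
  open ThreeUniformHypergraph H
  field
    nonzero       : ∀ v → NonzeroVector (x v)
    distinct-rays : ∀ u v → u ≢ v → ¬ SameRay (x u) (x v)
    orthogonality : ∀ u v → u ≢ v → ⟨ x u , x v ⟩ ≃ 0ℂ ⇔ InCommonEdge u v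

-- corner j is v_{j,j+1}
data Vertex : Set where
  midpoint corner : Fin 8 → Vertex
  a₁ a₂ b₁ b₂     : Vertex

data Hyperedge : Set where
  cyclic           : Fin 8 → Hyperedge
  D₀ D₁ D₂ D₃      : Hyperedge

next prev : Fin 8 → Fin 8
next j = (toℕ j ℕ.+ 1) mod 8
prev j = (toℕ j ℕ.+ 7) mod 8

edge₂₀ : Hyperedge → Vector Vertex 3
edge₂₀ (cyclic j) = corner (prev j) ∷ midpoint j ∷ corner j ∷ []
edge₂₀ D₀ = midpoint 0F ∷ a₁ ∷ midpoint 4F ∷ []
edge₂₀ D₁ = midpoint 1F ∷ b₂ ∷ midpoint 5F ∷ []
edge₂₀ D₂ = midpoint 2F ∷ a₂ ∷ midpoint 6F ∷ []
edge₂₀ D₃ = midpoint 3F ∷ b₁ ∷ midpoint 7F ∷ []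

private
  code : Vertex → ℕ
  code (midpoint j) = toℕ j
  code (corner j)   = 8 ℕ.+ toℕ j
  code a₁ = 16
  code a₂ = 17
  code b₁ = 18
  code b₂ = 19

  codes-distinct? : ∀ e → Dec (∀ k l → code (edge₂₀ e k) ≡ code (edge₂₀ e l) → k ≡ l)
  codes-distinct? e = all? λ k → all? λ l →
    (code (edge₂₀ e k) ℕ.≟ code (edge₂₀ e l)) →-dec (k Fin.≟ l)

  distinct₂₀ : ∀ e → Injective _≡_ _≡_ (edge₂₀ e)
  distinct₂₀ (cyclic j) = from-yes (all? (codes-distinct? ∘ cyclic)) j _ _ ∘ cong code
  distinct₂₀ D₀ = from-yes (codes-distinct? D₀) _ _ ∘ cong code
  distinct₂₀ D₁ = from-yes (codes-distinct? D₁) _ _ ∘ cong code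
  distinct₂₀ D₂ = from-yes (codes-distinct? D₂) _ _ ∘ cong code
  distinct₂₀ D₃ = from-yes (codes-distinct? D₃) _ _ ∘ cong code

  marker : Hyperedge → Vertex
  marker (cyclic j) = midpoint j
  marker D₀ = a₁
  marker D₁ = b₂
  marker D₂ = a₂
  marker D₃ = b₁

  marker-on : ∀ e → edge₂₀ e 1F ≡ marker e
  marker-on (cyclic j) = refl
  marker-on D₀ = refl
  marker-on D₁ = refl
  marker-on D₂ = refl
  marker-on D₃ = refl

  _∈₂₀_ : Vertex → Hyperedge → Set
  v ∈₂₀ e = ∃[ k ] edge₂₀ e k ≡ v

  markers-determine : ∀ e f → marker e ∈₂₀ f → marker f ∈₂₀ e → e ≡ f
  markers-determine (cyclic _) (cyclic _) (1F , refl) _ = refl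
  markers-determine (cyclic _) (cyclic _) (2F , ()) _
  markers-determine (cyclic _) D₀ _ (0F , ())
  markers-determine (cyclic _) D₀ _ (1F , ())
  markers-determine (cyclic _) D₀ _ (2F , ())
  markers-determine (cyclic _) D₁ _ (0F , ())
  markers-determine (cyclic _) D₁ _ (1F , ())
  markers-determine (cyclic _) D₁ _ (2F , ())
  markers-determine (cyclic _) D₂ _ (0F , ())
  markers-determine (cyclic _) D₂ _ (1F , ())
  markers-determine (cyclic _) D₂ _ (2F , ())
  markers-determine (cyclic _) D₃ _ (0F , ())
  markers-determine (cyclic _) D₃ _ (1F , ())
  markers-determine (cyclic _) D₃ _ (2F , ())
  markers-determine D₀ D₀ _ _ = refl
  markers-determine D₁ D₁ _ _ = refl
  markers-determine D₂ D₂ _ _ = refl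
  markers-determine D₃ D₃ _ _ = refl
  markers-determine D₀ (cyclic _) (0F , ()) _
  markers-determine D₀ (cyclic _) (1F , ()) _
  markers-determine D₀ (cyclic _) (2F , ()) _
  markers-determine D₁ (cyclic _) (0F , ()) _
  markers-determine D₁ (cyclic _) (1F , ()) _
  markers-determine D₁ (cyclic _) (2F , ()) _
  markers-determine D₂ (cyclic _) (0F , ()) _
  markers-determine D₂ (cyclic _) (1F , ()) _
  markers-determine D₂ (cyclic _) (2F , ()) _
  markers-determine D₃ (cyclic _) (0F , ()) _
  markers-determine D₃ (cyclic _) (1F , ()) _
  markers-determine D₃ (cyclic _) (2F , ()) _
  markers-determine D₀ D₁ (1F , ()) _
  markers-determine D₀ D₁ (2F , ()) _
  markers-determine D₀ D₂ (1F , ()) _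
  markers-determine D₀ D₂ (2F , ()) _
  markers-determine D₀ D₃ (1F , ()) _
  markers-determine D₀ D₃ (2F , ()) _
  markers-determine D₁ D₀ (1F , ()) _
  markers-determine D₁ D₀ (2F , ()) _
  markers-determine D₁ D₂ (1F , ()) _
  markers-determine D₁ D₂ (2F , ()) _
  markers-determine D₁ D₃ (1F , ()) _
  markers-determine D₁ D₃ (2F , ()) _
  markers-determine D₂ D₀ (1F , ()) _
  markers-determine D₂ D₀ (2F , ()) _
  markers-determine D₂ D₁ (1F , ()) _
  markers-determine D₂ D₁ (2F , ()) _
  markers-determine D₂ D₃ (1F , ()) _
  markers-determine D₂ D₃ (2F , ()) _
  markers-determine D₃ D₀ (1F , ()) _
  markers-determine D₃ D₀ (2F , ()) _
  markers-determine D₃ D₁ (1F , ()) _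
  markers-determine D₃ D₁ (2F , ()) _
  markers-determine D₃ D₂ (1F , ()) _
  markers-determine D₃ D₂ (2F , ()) _

H₂₀ : ThreeUniformHypergraph
H₂₀ = record
  { V             = Vertex
  ; E             = Hyperedge
  ; edge          = edge₂₀
  ; edge-distinct = distinct₂₀
  ; edge-set      = λ e f same → markers-determine e f
      (to   (same (marker e)) (1F , marker-on e))
      (from (same (marker f)) (1F , marker-on f))
  }
  where open Function.Bundles.Equivalence using (to; from)

√69 C s N r : ℝ
√69 = √ fromℚ (+ 69 / 1)
C   = fromℚ (+ 1 / 26) *ᴿ (fromℚ (+ 49 / 1) -ᴿ fromℚ (+ 5 / 1) *ᴿ √69)
s   = √ C
N   = fromℚ 1ℚ +ᴿ C
r   = √ N

η ζ : ℂ
η = fromℚ (+ 5 / 13) +i fromℚ (+ 12 / 13)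
ζ = fromℚ (+ 1 / 65) *ᴿ (fromℚ (+ 14 / 1) +ᴿ fromℚ (+ 6 / 1) *ᴿ √69)
 +i fromℚ (+ 1 / 65) *ᴿ (fromℚ (+ 4 / 1) *ᴿ √69 -ᴿ fromℚ (+ 21 / 1))

μ τ : Vector ℂ 8
μ = - 1ℂ ∷ η ∷ 1ℂ ∷ - η ∷ - 1ℂ ∷ η ∷ 1ℂ ∷ - η ∷ []
τ = 1ℂ ∷ ζ ∷ - i ∷ - (i * ζ) ∷ - 1ℂ ∷ - ζ ∷ i ∷ i * ζ ∷ []

v : Fin 8 → Vector ℂ 3
v j = 1ℂ ∷ fromℝ s * μ j ∷ fromℝ r * τ j ∷ []

vectors : Vertex → Vector ℂ 3
vectors (midpoint j) = v j
vectors (corner j)   = conj ∘ cross (v j) (v (next j))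
vectors a₁ = fromℝ s ∷ 1ℂ   ∷ 0ℂ ∷ []
vectors a₂ = fromℝ s ∷ - 1ℂ ∷ 0ℂ ∷ []
vectors b₁ = fromℝ s ∷ η    ∷ 0ℂ ∷ []
vectors b₂ = fromℝ s ∷ - η  ∷ 0ℂ ∷ []

cornerFormula : Fin 8 → Vector ℂ 3
cornerFormula j = let k = next j in
    fromℝ s * fromℝ r * (conj (μ j) * conj (τ k) - conj (τ j) * conj (μ k))
  ∷ fromℝ r * (conj (τ j) - conj (τ k))
  ∷ fromℝ s * (conj (μ k) - conj (μ j))
  ∷ []

{-# OPTIONS --safe #-}
-- All coordinates lie in ℚ(i, √69, s, r), where s = √C with C ∈ ℚ(√69) and r = √N with
-- N = 1 + C, so every inner product can be computed exactly. It is recognised as zero by its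
-- coordinates, and as nonzero by an iterated norm down to ℚ(i); the resulting table is the
-- adjacency relation of H₂₀, also on the diagonal. The other two properties follow from this:
-- a vector orthogonal to everything would make its vertex adjacent to itself, and any two
-- vertices u ≠ v are separated by a neighbour of v that is not a neighbour of u.
module Submission where

open import Algebra.Bundles using (CommutativeRing)
open import Algebra.Solver.Ring.AlmostCommutativeRing
  using (fromCommutativeRing; _-Raw-AlmostCommutative⟶_)
import Algebra.Solver.Ring as RingSolver
import Data.Bool.Properties as Bool
open import Data.Fin.Base using (Fin; suc; _↑ˡ_; _↑ʳ_; splitAt)
open import Data.Fin.Patterns
open import Data.Fin.Properties using (all?; any?; splitAt-↑ˡ)
import Data.Fin.Properties as Fin
open import Data.Integer.Base using (+_)
open import Data.Maybe.Base using (Maybe; just; nothing)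
import Data.Maybe.Base as Maybe
import Data.Maybe.Properties as Maybe
import Data.Nat.Base as ℕ
import Data.Nat.Properties as ℕ
open import Data.Product.Base using (_×_; _,_; proj₁; proj₂; ∃-syntax)
open import Data.Rational.Base using (ℚ; 0ℚ; 1ℚ; ½; _/_; ∣_∣)
import Data.Rational.Base as ℚ
import Data.Rational.Properties as ℚ
open import Data.Rational.Solver using (module +-*-Solver)
open import Data.Sum.Base using (_⊎_; inj₁; inj₂; [_,_]′)
open import Data.Vec.Functional using (Vector; []; _∷_)
open import Function.Base using (_∘_)
open import Function.Bundles using (_⇔_; mk⇔; module Equivalence)
open import Level using (0ℓ)
open import Relation.Binary.Definitions using (DecidableEquality)
open import Relation.Binary.Structures using (IsEquivalence)
open import Relation.Binary.PropositionalEquality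
  using (_≡_; _≢_; refl; sym; trans; cong; cong₂; subst; module ≡-Reasoning)
open import Relation.Nullary using (Dec; yes; no; does; ¬_)
open import Relation.Nullary.Decidable
  using (map′; _×-dec_; _⊎-dec_; _→-dec_; ¬?; from-yes; dec⇒maybe)
open import Relation.Nullary.Negation using (contradiction)
open import Defs

open ℚ-lemmas
open Equivalence using (to; from)
private module Q = +-*-Solver

-- ℂ as a commutative ring

pointwiseᴿ : ∀ {x y} → (∀ n → seq x n ≡ seq y n) → x ≃ᴿ y
pointwiseᴿ {x} {y} eq ε 0<ε = 0 , λ n _ → subst (ℚ._< ε)
  (cong ∣_∣ (trans (sym (ℚ.+-inverseʳ (seq y n))) (cong (ℚ._- seq y n) (sym (eq n))))) 0<ε

symᴿ : ∀ {x y} → x ≃ᴿ y → y ≃ᴿ x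
symᴿ {x} {y} x≃y ε 0<ε with x≃y ε 0<ε
... | M , near = M , λ n n≥ → subst (ℚ._< ε) (∣-∣-comm (seq x n) (seq y n)) (near n n≥)

-- The ε/2 argument behind both transitivity and compatibility with addition.
sum-close : ∀ {p q r ε} → p ≡ q ℚ.+ r → ∣ q ∣ ℚ.< ½ ℚ.* ε → ∣ r ∣ ℚ.< ½ ℚ.* ε → ∣ p ∣ ℚ.< ε
sum-close {p} {q} {r} {ε} p≡q+r ∣q∣< ∣r∣< = begin-strict
  ∣ p ∣                      ≡⟨ cong ∣_∣ p≡q+r ⟩
  ∣ q ℚ.+ r ∣                ≤⟨ ℚ.∣p+q∣≤∣p∣+∣q∣ q r ⟩
  ∣ q ∣ ℚ.+ ∣ r ∣            <⟨ ℚ.+-mono-< ∣q∣< ∣r∣< ⟩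
  ½ ℚ.* ε ℚ.+ ½ ℚ.* ε        ≡⟨ half+half ε ⟩
  ε                          ∎
  where open ℚ.≤-Reasoning

transᴿ : ∀ {x y z} → x ≃ᴿ y → y ≃ᴿ z → x ≃ᴿ z
transᴿ {x} {y} {z} x≃y y≃z ε 0<ε =
  let
    K , near  = x≃y (½ ℚ.* ε) (half-pos 0<ε)
    L , near′ = y≃z (½ ℚ.* ε) (half-pos 0<ε)
  in K ℕ.⊔ L , λ n n≥ → sum-close
    (Q.solve 3 (λ x y z → x Q.:- z Q.:= (x Q.:- y) Q.:+ (y Q.:- z)) refl
      (seq x n) (seq y n) (seq z n))
    (near n (ℕ.m⊔n≤o⇒m≤o K L n≥)) (near′ n (ℕ.m⊔n≤o⇒n≤o K L n≥))

+ᴿ-cong : ∀ {x x′ y y′} → x ≃ᴿ x′ → y ≃ᴿ y′ → x +ᴿ y ≃ᴿ x′ +ᴿ y′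
+ᴿ-cong {x} {x′} {y} {y′} x≃x′ y≃y′ ε 0<ε =
  let
    K , near  = x≃x′ (½ ℚ.* ε) (half-pos 0<ε)
    L , near′ = y≃y′ (½ ℚ.* ε) (half-pos 0<ε)
  in K ℕ.⊔ L , λ n n≥ → sum-close
    (Q.solve 4 (λ x x′ y y′ → (x Q.:+ y) Q.:- (x′ Q.:+ y′) Q.:= (x Q.:- x′) Q.:+ (y Q.:- y′))
      refl (seq x n) (seq x′ n) (seq y n) (seq y′ n))
    (near n (ℕ.m⊔n≤o⇒m≤o K L n≥)) (near′ n (ℕ.m⊔n≤o⇒n≤o K L n≥))

-ᴿ-cong : ∀ {x y} → x ≃ᴿ y → -ᴿ x ≃ᴿ -ᴿ y
-ᴿ-cong {x} {y} x≃y ε 0<ε =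
  let M , near = symᴿ {x} {y} x≃y ε 0<ε in M , λ n n≥ →
    subst (λ p → ∣ p ∣ ℚ.< ε) (swap (seq x n) (seq y n)) (near n n≥)
  where
  swap : ∀ p q → q ℚ.- p ≡ ℚ.- p ℚ.- ℚ.- q
  swap = Q.solve 2 (λ p q → q Q.:- p Q.:= Q.:- p Q.:- Q.:- q) refl

-- Split x y - x′ y′ as x (y - y′) + y′ (x - x′). The Cauchy sequences `x` and `y′` are eventually
-- bounded by A and B, so differences below ε/(2A) and ε/(2B) suffice.
*ᴿ-cong : ∀ {x x′ y y′} → x ≃ᴿ x′ → y ≃ᴿ y′ → x *ᴿ y ≃ᴿ x′ *ᴿ y′
*ᴿ-cong {x} {x′} {y} {y′} x≃x′ y≃y′ ε 0<ε =
  let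
    A , 0<A , J , ∣x∣≤A  = Cauchy.bound (seq x) (cauchy x)
    B , 0<B , K , ∣y′∣≤B = Cauchy.bound (seq y′) (cauchy y′)
    δ , 0<δ , Aδ         = scale-below 0<A (half-pos 0<ε)
    δ′ , 0<δ′ , Bδ′      = scale-below 0<B (half-pos 0<ε)
    L , near-y           = y≃y′ δ 0<δ
    M , near-x           = x≃x′ δ′ 0<δ′
  in (J ℕ.⊔ K) ℕ.⊔ (L ℕ.⊔ M) , λ n n≥ →
  let
    n≥₁ = ℕ.m⊔n≤o⇒m≤o (J ℕ.⊔ K) (L ℕ.⊔ M) n≥
    n≥₂ = ℕ.m⊔n≤o⇒n≤o (J ℕ.⊔ K) (L ℕ.⊔ M) n≥
  in subst (∣ seq x n ℚ.* seq y n ℚ.- seq x′ n ℚ.* seq y′ n ∣ ℚ.<_)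
       (trans (cong₂ ℚ._+_ Aδ Bδ′) (half+half ε))
       (product-close {seq x n} {seq y n} {seq x′ n} {seq y′ n} 0<A 0<B
         (∣x∣≤A n (ℕ.m⊔n≤o⇒m≤o J K n≥₁)) (∣y′∣≤B n (ℕ.m⊔n≤o⇒n≤o J K n≥₁))
         (near-y n (ℕ.m⊔n≤o⇒m≤o L M n≥₂)) (near-x n (ℕ.m⊔n≤o⇒n≤o L M n≥₂)))

-- If p and q differed, the choice ε = ∣ p - q ∣ would make the constant distance smaller than
-- itself. Every proof that a complex number is nonzero goes back to this.
fromℚ-injective : ∀ {p q} → fromℚ p ≃ᴿ fromℚ q → p ≡ q
fromℚ-injective {p} {q} p≃q with 0ℚ ℚ.<? ∣ p ℚ.- q ∣
... | no 0≮∣p-q∣ = begin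
  p                ≡⟨ Q.solve 2 (λ p q → p Q.:= (p Q.:- q) Q.:+ q) refl p q ⟩
  p ℚ.- q ℚ.+ q    ≡⟨ cong (ℚ._+ q) (ℚ.∣p∣≡0⇒p≡0 (p ℚ.- q)
                        (ℚ.≤-antisym (ℚ.≮⇒≥ 0≮∣p-q∣) (ℚ.0≤∣p∣ (p ℚ.- q)))) ⟩
  0ℚ ℚ.+ q         ≡⟨ ℚ.+-identityˡ q ⟩
  q                ∎
  where open ≡-Reasoning
... | yes 0<∣p-q∣ with p≃q ∣ p ℚ.- q ∣ 0<∣p-q∣
...   | M , near = contradiction (near M ℕ.≤-refl) (ℚ.<-irrefl refl)

infix 4 _≈_

-- A record, so that unification can recover z and w from z ≈ w.
record _≈_ (z w : ℂ) : Set where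
  constructor equal
  field ≈⇒≃ : z ≃ w
open _≈_ public

-- The operations act termwise on the sequences, so each ring law reduces to an identity in ℚ, with
-- no limit argument.
pointwise : ∀ {z w} → (∀ n → seq (re z) n ≡ seq (re w) n) →
            (∀ n → seq (im z) n ≡ seq (im w) n) → z ≈ w
pointwise {z} {w} eq eq′ = equal
  (pointwiseᴿ {re z} {re w} eq , pointwiseᴿ {im z} {im w} eq′)

≈-isEquivalence : IsEquivalence _≈_
≈-isEquivalence = record
  { refl  = pointwise (λ _ → refl) (λ _ → refl)
  ; sym   = λ { {z} {w} (equal (p , q)) → equal
      (symᴿ {re z} {re w} p , symᴿ {im z} {im w} q) }
  ; trans = λ { {z} {w} {u} (equal (p , q)) (equal (p′ , q′)) → equal
      (transᴿ {re z} {re w} {re u} p p′ , transᴿ {im z} {im w} {im u} q q′) }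
  }

+-cong : ∀ {z z′ w w′} → z ≈ z′ → w ≈ w′ → z + w ≈ z′ + w′
+-cong {z} {z′} {w} {w′} (equal (p , q)) (equal (p′ , q′)) = equal
  (+ᴿ-cong {re z} {re z′} {re w} {re w′} p p′ , +ᴿ-cong {im z} {im z′} {im w} {im w′} q q′)

neg-cong : ∀ {z w} → z ≈ w → - z ≈ - w
neg-cong {z} {w} (equal (p , q)) =
  equal (-ᴿ-cong {re z} {re w} p , -ᴿ-cong {im z} {im w} q)

conj-cong : ∀ {z w} → z ≈ w → conj z ≈ conj w
conj-cong {z} {w} (equal (p , q)) = equal (p , -ᴿ-cong {im z} {im w} q)

*-cong : ∀ {z z′ w w′} → z ≈ z′ → w ≈ w′ → z * w ≈ z′ * w′
*-cong {z} {z′} {w} {w′} (equal (p , q)) (equal (p′ , q′)) = equal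
  ( +ᴿ-cong {re z *ᴿ re w} {re z′ *ᴿ re w′} { -ᴿ (im z *ᴿ im w)} { -ᴿ (im z′ *ᴿ im w′)}
      (*ᴿ-cong {re z} {re z′} {re w} {re w′} p p′)
      (-ᴿ-cong {im z *ᴿ im w} {im z′ *ᴿ im w′} (*ᴿ-cong {im z} {im z′} {im w} {im w′} q q′))
  , +ᴿ-cong {re z *ᴿ im w} {re z′ *ᴿ im w′} {im z *ᴿ re w} {im z′ *ᴿ re w′}
      (*ᴿ-cong {re z} {re z′} {im w} {im w′} p q′)
      (*ᴿ-cong {im z} {im z′} {re w} {re w′} q p′) )

ℂ-commutativeRing : CommutativeRing 0ℓ 0ℓ
ℂ-commutativeRing = record
  { Carrier = ℂ
  ; _≈_ = _≈_
  ; _+_ = _+_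
  ; _*_ = _*_
  ; -_ = -_
  ; 0# = 0ℂ
  ; 1# = 1ℂ
  ; isCommutativeRing = record
    { isRing = record
      { +-isAbelianGroup = record
        { isGroup = record
          { isMonoid = record
            { isSemigroup = record
              { isMagma = record { isEquivalence = ≈-isEquivalence ; ∙-cong = +-cong }
              ; assoc = λ x y z → pointwise
                  (λ n → ℚ.+-assoc (seq (re x) n) (seq (re y) n) (seq (re z) n))
                  (λ n → ℚ.+-assoc (seq (im x) n) (seq (im y) n) (seq (im z) n))
              }
            ; identity =
                (λ z → pointwise (λ _ → ℚ.+-identityˡ _) (λ _ → ℚ.+-identityˡ _))
              , (λ z → pointwise (λ _ → ℚ.+-identityʳ _) (λ _ → ℚ.+-identityʳ _))
            }
          ; inverse =
              (λ z → pointwise (λ n → ℚ.+-inverseˡ (seq (re z) n)) (λ n → ℚ.+-inverseˡ (seq (im z) n)))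
            , (λ z → pointwise (λ n → ℚ.+-inverseʳ (seq (re z) n)) (λ n → ℚ.+-inverseʳ (seq (im z) n)))
          ; ⁻¹-cong = neg-cong
          }
        ; comm = λ z w → pointwise
            (λ n → ℚ.+-comm (seq (re z) n) (seq (re w) n))
            (λ n → ℚ.+-comm (seq (im z) n) (seq (im w) n))
        }
      ; *-cong = *-cong
      ; *-assoc = λ x y z → pointwise
          (λ n → Q.solve 6 (λ x x′ y y′ z z′ →
            (x :* y :- x′ :* y′) :* z :- (x :* y′ :+ x′ :* y) :* z′ :=
            x :* (y :* z :- y′ :* z′) :- x′ :* (y :* z′ :+ y′ :* z)) refl
            (seq (re x) n) (seq (im x) n) (seq (re y) n) (seq (im y) n) (seq (re z) n) (seq (im z) n))
          (λ n → Q.solve 6 (λ x x′ y y′ z z′ →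
            (x :* y :- x′ :* y′) :* z′ :+ (x :* y′ :+ x′ :* y) :* z :=
            x :* (y :* z′ :+ y′ :* z) :+ x′ :* (y :* z :- y′ :* z′)) refl
            (seq (re x) n) (seq (im x) n) (seq (re y) n) (seq (im y) n) (seq (re z) n) (seq (im z) n))
      ; *-identity =
          (λ z → pointwise
            (λ n → Q.solve 2 (λ x y → con 1ℚ :* x :- con 0ℚ :* y := x) refl (seq (re z) n) (seq (im z) n))
            (λ n → Q.solve 2 (λ x y → con 1ℚ :* y :+ con 0ℚ :* x := y) refl (seq (re z) n) (seq (im z) n)))
        , (λ z → pointwise
            (λ n → Q.solve 2 (λ x y → x :* con 1ℚ :- y :* con 0ℚ := x) refl (seq (re z) n) (seq (im z) n))
            (λ n → Q.solve 2 (λ x y → x :* con 0ℚ :+ y :* con 1ℚ := y) refl (seq (re z) n) (seq (im z) n)))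
      ; distrib =
          (λ x y z → pointwise
            (λ n → Q.solve 6 (λ x x′ y y′ z z′ →
              x :* (y :+ z) :- x′ :* (y′ :+ z′) := (x :* y :- x′ :* y′) :+ (x :* z :- x′ :* z′)) refl
              (seq (re x) n) (seq (im x) n) (seq (re y) n) (seq (im y) n) (seq (re z) n) (seq (im z) n))
            (λ n → Q.solve 6 (λ x x′ y y′ z z′ →
              x :* (y′ :+ z′) :+ x′ :* (y :+ z) := (x :* y′ :+ x′ :* y) :+ (x :* z′ :+ x′ :* z)) refl
              (seq (re x) n) (seq (im x) n) (seq (re y) n) (seq (im y) n) (seq (re z) n) (seq (im z) n)))
        , (λ x y z → pointwise
            (λ n → Q.solve 6 (λ x x′ y y′ z z′ →
              (y :+ z) :* x :- (y′ :+ z′) :* x′ := (y :* x :- y′ :* x′) :+ (z :* x :- z′ :* x′)) refl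
              (seq (re x) n) (seq (im x) n) (seq (re y) n) (seq (im y) n) (seq (re z) n) (seq (im z) n))
            (λ n → Q.solve 6 (λ x x′ y y′ z z′ →
              (y :+ z) :* x′ :+ (y′ :+ z′) :* x := (y :* x′ :+ y′ :* x) :+ (z :* x′ :+ z′ :* x)) refl
              (seq (re x) n) (seq (im x) n) (seq (re y) n) (seq (im y) n) (seq (re z) n) (seq (im z) n)))
      }
    ; *-comm = λ z w → pointwise
        (λ n → Q.solve 4 (λ x x′ y y′ → x :* y :- x′ :* y′ := y :* x :- y′ :* x′) refl
          (seq (re z) n) (seq (im z) n) (seq (re w) n) (seq (im w) n))
        (λ n → Q.solve 4 (λ x x′ y y′ → x :* y′ :+ x′ :* y := y :* x′ :+ y′ :* x) refl
          (seq (re z) n) (seq (im z) n) (seq (re w) n) (seq (im w) n))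
    }
  }
  where open Q using (_:+_; _:*_; _:-_; _:=_; con)

-- Polynomial identities over ℂ with rational coefficients

open CommutativeRing ℂ-commutativeRing
  using (+-identityˡ; +-identityʳ; zeroˡ; zeroʳ; *-identityˡ)
  renaming (refl to ≈-refl; sym to ≈-sym; trans to ≈-trans)

ℚ⟶ℂ : CommutativeRing.rawRing ℚ.+-*-commutativeRing
        -Raw-AlmostCommutative⟶ fromCommutativeRing ℂ-commutativeRing
ℚ⟶ℂ = record
  { ⟦_⟧    = fromℝ ∘ fromℚ
  ; +-homo = λ _ _ → pointwise (λ _ → refl) (λ _ → refl)
  ; *-homo = λ p q → pointwise
      (λ _ → Q.solve 2 (λ p q → p Q.:* q Q.:= p Q.:* q Q.:- Q.con 0ℚ Q.:* Q.con 0ℚ) refl p q)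
      (λ _ → Q.solve 2 (λ p q → Q.con 0ℚ Q.:= p Q.:* Q.con 0ℚ Q.:+ Q.con 0ℚ Q.:* q) refl p q)
  ; -‿homo = λ _ → pointwise (λ _ → refl) (λ _ → refl)
  ; 0-homo = ≈-refl
  ; 1-homo = ≈-refl
  }

open RingSolver (CommutativeRing.rawRing ℚ.+-*-commutativeRing)
  (fromCommutativeRing ℂ-commutativeRing) ℚ⟶ℂ
  (λ p q → Maybe.map (λ p≡q → pointwise (λ _ → p≡q) (λ _ → refl)) (dec⇒maybe (p ℚ.≟ q)))
  using (solve; _:=_; _:+_; _:*_; _:-_; :-_; con)

-- The embedding of ℝ and complex conjugation as homomorphisms

fromℝ-cong : ∀ {x y} → x ≃ᴿ y → fromℝ x ≈ fromℝ y
fromℝ-cong x≃y = equal (x≃y , pointwiseᴿ {fromℚ 0ℚ} {fromℚ 0ℚ} (λ _ → refl))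

fromℝ-+ : ∀ x y → fromℝ (x +ᴿ y) ≈ fromℝ x + fromℝ y
fromℝ-+ x y = pointwise (λ _ → refl) (λ _ → refl)

fromℝ-neg : ∀ x → fromℝ (-ᴿ x) ≈ - fromℝ x
fromℝ-neg x = pointwise (λ _ → refl) (λ _ → refl)

fromℝ-* : ∀ x y → fromℝ (x *ᴿ y) ≈ fromℝ x * fromℝ y
fromℝ-* x y = pointwise
  (λ n → Q.solve 2 (λ p q → p Q.:* q Q.:= p Q.:* q Q.:- Q.con 0ℚ Q.:* Q.con 0ℚ) refl
    (seq x n) (seq y n))
  (λ n → Q.solve 2 (λ p q → Q.con 0ℚ Q.:= p Q.:* Q.con 0ℚ Q.:+ Q.con 0ℚ Q.:* q) refl
    (seq x n) (seq y n))

+i-decompose : ∀ x y → x +i y ≈ fromℝ x + i * fromℝ y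
+i-decompose x y = pointwise
  (λ n → Q.solve 2 (λ p q → p Q.:= p Q.:+ (Q.con 0ℚ Q.:* q Q.:- Q.con 1ℚ Q.:* Q.con 0ℚ)) refl
    (seq x n) (seq y n))
  (λ n → Q.solve 1 (λ q →
    q Q.:= Q.con 0ℚ Q.:+ (Q.con 0ℚ Q.:* Q.con 0ℚ Q.:+ Q.con 1ℚ Q.:* q)) refl (seq y n))

conj-fromℝ : ∀ x → conj (fromℝ x) ≈ fromℝ x
conj-fromℝ x = pointwise (λ _ → refl) (λ _ → refl)

conj-+ : ∀ z w → conj (z + w) ≈ conj z + conj w
conj-+ z w = pointwise (λ _ → refl) (λ n → ℚ.neg-distrib-+ (seq (im z) n) (seq (im w) n))

conj-neg : ∀ z → conj (- z) ≈ - conj z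
conj-neg z = pointwise (λ _ → refl) (λ _ → refl)

conj-* : ∀ z w → conj (z * w) ≈ conj z * conj w
conj-* z w = pointwise
  (λ n → Q.solve 4 (λ x x′ y y′ →
    x Q.:* y Q.:- x′ Q.:* y′ Q.:= x Q.:* y Q.:- (Q.:- x′) Q.:* (Q.:- y′)) refl
    (seq (re z) n) (seq (im z) n) (seq (re w) n) (seq (im w) n))
  (λ n → Q.solve 4 (λ x x′ y y′ →
    Q.:- (x Q.:* y′ Q.:+ x′ Q.:* y) Q.:= x Q.:* (Q.:- y′) Q.:+ (Q.:- x′) Q.:* y) refl
    (seq (re z) n) (seq (im z) n) (seq (re w) n) (seq (im w) n))

-- Exact arithmetic in iterated quadratic extensions of ℚ(i)

-- A subring of ℂ stable under conjugation, presented by codes on which one can compute. A number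
-- may have several codes, so the zero test concerns values; `nothing` is the answer of an
-- inconclusive test.
record Subring : Set₁ where
  infixl 6 _⊕_
  infixl 7 _⊗_
  infix  8 ⊖_
  field
    Code      : Set
    𝟘 𝟙       : Code
    _⊕_ _⊗_   : Code → Code → Code
    ⊖_ _†     : Code → Code
    ⟦_⟧       : Code → ℂ
    ⟦𝟘⟧       : ⟦ 𝟘 ⟧ ≈ 0ℂ
    ⟦𝟙⟧       : ⟦ 𝟙 ⟧ ≈ 1ℂ
    ⟦⊕⟧       : ∀ x y → ⟦ x ⊕ y ⟧ ≈ ⟦ x ⟧ + ⟦ y ⟧
    ⟦⊗⟧       : ∀ x y → ⟦ x ⊗ y ⟧ ≈ ⟦ x ⟧ * ⟦ y ⟧
    ⟦⊖⟧       : ∀ x → ⟦ ⊖ x ⟧ ≈ - ⟦ x ⟧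
    ⟦†⟧       : ∀ x → ⟦ x † ⟧ ≈ conj ⟦ x ⟧
    vanishes? : ∀ x → Maybe (Dec (⟦ x ⟧ ≈ 0ℂ))

-- nothing is a second code of zero: it lets products with vanishing coordinates, the vast
-- majority in the Gram matrix, skip rational arithmetic.
ℚ[i] : Subring
ℚ[i] = record
  { Code = Maybe (ℚ × ℚ)
  ; 𝟘    = nothing
  ; 𝟙    = just (1ℚ , 0ℚ)
  ; _⊕_  = plus
  ; _⊗_  = times
  ; ⊖_   = Maybe.map λ (p , q) → ℚ.- p , ℚ.- q
  ; _†   = Maybe.map λ (p , q) → p , ℚ.- q
  ; ⟦_⟧  = val
  ; ⟦𝟘⟧  = ≈-refl
  ; ⟦𝟙⟧  = ≈-refl
  ; ⟦⊕⟧  = val-plus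
  ; ⟦⊗⟧  = val-times
  ; ⟦⊖⟧  = λ where
      nothing  → pointwise (λ _ → refl) (λ _ → refl)
      (just _) → pointwise (λ _ → refl) (λ _ → refl)
  ; ⟦†⟧  = λ where
      nothing  → pointwise (λ _ → refl) (λ _ → refl)
      (just _) → pointwise (λ _ → refl) (λ _ → refl)
  ; vanishes? = λ where
      nothing        → just (yes ≈-refl)
      (just (p , q)) → just (map′
        (λ (p≡0 , q≡0) → pointwise (λ _ → p≡0) (λ _ → q≡0))
        (λ (equal (p≃0 , q≃0)) → fromℚ-injective p≃0 , fromℚ-injective q≃0)
        (p ℚ.≟ 0ℚ ×-dec q ℚ.≟ 0ℚ))
  }
  where
  val : Maybe (ℚ × ℚ) → ℂ
  val nothing        = 0ℂ
  val (just (p , q)) = fromℚ p +i fromℚ q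

  plus times : Maybe (ℚ × ℚ) → Maybe (ℚ × ℚ) → Maybe (ℚ × ℚ)
  plus nothing        y                = y
  plus x              nothing          = x
  plus (just (p , q)) (just (p′ , q′)) = just (p ℚ.+ p′ , q ℚ.+ q′)
  times (just (p , q)) (just (p′ , q′)) = just (p ℚ.* p′ ℚ.- q ℚ.* q′ , p ℚ.* q′ ℚ.+ q ℚ.* p′)
  times _              _                = nothing

  val-plus : ∀ x y → val (plus x y) ≈ val x + val y
  val-plus nothing  y        = ≈-sym (+-identityˡ (val y))
  val-plus (just x) nothing  = ≈-sym (+-identityʳ (val (just x)))
  val-plus (just _) (just _) = pointwise (λ _ → refl) (λ _ → refl)

  val-times : ∀ x y → val (times x y) ≈ val x * val y
  val-times nothing  y        = ≈-sym (zeroˡ (val y))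
  val-times (just x) nothing  = ≈-sym (zeroʳ (val (just x)))
  val-times (just _) (just _) = pointwise (λ _ → refl) (λ _ → refl)

-- Indexing by the value `z` lets a code be assembled by copying the expression for `z`, its
-- correctness being carried along.
record Exact (A : Subring) (z : ℂ) : Set where
  constructor exact
  open Subring A
  field
    code  : Code
    sound : ⟦ code ⟧ ≈ z

open Exact public

module Arithmetic (A : Subring) where
  open Subring A

  infixl 6 _+′_ _-′_
  infixl 7 _*′_
  infix  8 -′_

  via : ∀ {z w} → z ≈ w → Exact A w → Exact A z
  via z≈w (exact x x≈w) = exact x (≈-trans x≈w (≈-sym z≈w))

  0′ : Exact A 0ℂ
  0′ = exact 𝟘 ⟦𝟘⟧

  1′ : Exact A 1ℂ
  1′ = exact 𝟙 ⟦𝟙⟧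

  _+′_ : ∀ {z w} → Exact A z → Exact A w → Exact A (z + w)
  exact x x≈z +′ exact y y≈w = exact (x ⊕ y) (≈-trans (⟦⊕⟧ x y) (+-cong x≈z y≈w))

  _*′_ : ∀ {z w} → Exact A z → Exact A w → Exact A (z * w)
  exact x x≈z *′ exact y y≈w = exact (x ⊗ y) (≈-trans (⟦⊗⟧ x y) (*-cong x≈z y≈w))

  -′_ : ∀ {z} → Exact A z → Exact A (- z)
  -′ exact x x≈z = exact (⊖ x) (≈-trans (⟦⊖⟧ x) (neg-cong x≈z))

  _-′_ : ∀ {z w} → Exact A z → Exact A w → Exact A (z - w)
  x -′ y = x +′ -′ y

  infixl 6 _+ᴿ′_ _-ᴿ′_
  infixl 7 _*ᴿ′_

  _+ᴿ′_ : ∀ {x y} → Exact A (fromℝ x) → Exact A (fromℝ y) → Exact A (fromℝ (x +ᴿ y))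
  _+ᴿ′_ {x} {y} x′ y′ = via (fromℝ-+ x y) (x′ +′ y′)

  _*ᴿ′_ : ∀ {x y} → Exact A (fromℝ x) → Exact A (fromℝ y) → Exact A (fromℝ (x *ᴿ y))
  _*ᴿ′_ {x} {y} x′ y′ = via (fromℝ-* x y) (x′ *′ y′)

  _-ᴿ′_ : ∀ {x y} → Exact A (fromℝ x) → Exact A (fromℝ y) → Exact A (fromℝ (x -ᴿ y))
  _-ᴿ′_ {y = y} x′ y′ = x′ +ᴿ′ via (fromℝ-neg y) (-′ y′)

  +i-exact : Exact A i → ∀ {x y} → Exact A (fromℝ x) → Exact A (fromℝ y) → Exact A (x +i y)
  +i-exact i′ {x} {y} x′ y′ = via (+i-decompose x y) (x′ +′ i′ *′ y′)

  conj′ : ∀ {z} → Exact A z → Exact A (conj z)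
  conj′ (exact x x≈z) = exact (x †) (≈-trans (⟦†⟧ x) (conj-cong x≈z))

  ⟨_,_⟩′ : ∀ {d} {x y : Vector ℂ d} → (∀ k → Exact A (x k)) → (∀ k → Exact A (y k)) →
           Exact A ⟨ x , y ⟩
  ⟨_,_⟩′ {ℕ.zero}  x y = 0′
  ⟨_,_⟩′ {ℕ.suc _} x y = conj′ (x 0F) *′ y 0F +′ ⟨ x ∘ suc , y ∘ suc ⟩′

  cross′ : ∀ {x y} → (∀ k → Exact A (x k)) → (∀ k → Exact A (y k)) → ∀ k → Exact A (cross x y k)
  cross′ x y 0F = x 1F *′ y 2F -′ x 2F *′ y 1F
  cross′ x y 1F = x 2F *′ y 0F -′ x 0F *′ y 2F
  cross′ x y 2F = x 0F *′ y 1F -′ x 1F *′ y 0F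

  zero? : ∀ {z} → Exact A z → Maybe (Dec (z ≈ 0ℂ))
  zero? (exact x x≈z) = Maybe.map (map′ (≈-trans (≈-sym x≈z)) (≈-trans x≈z)) (vanishes? x)

-- The pair (a , b) stands for a + b √x, multiplied as in A[X]/(X² - x). Different pairs may have
-- the same value, namely when `x` is already a square in `A`.
module AdjoinRoot (A : Subring) (x : ℝ) (0≤x : 0≤ᴿ x) (x′ : Exact A (fromℝ x)) where
  open Subring A
  open Exact x′ renaming (code to c; sound to c≈x)

  ρ : ℂ
  ρ = fromℝ (√ x)

  -- Nonnegativity of `x` enters here, through `√-square`.
  c≈ρ² : ⟦ c ⟧ ≈ ρ * ρ
  c≈ρ² = ≈-trans c≈x (≈-trans (≈-sym (fromℝ-cong (√-square x 0≤x))) (fromℝ-* (√ x) (√ x)))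

  val : Code × Code → ℂ
  val (a , b) = ⟦ a ⟧ + ⟦ b ⟧ * ρ

  val-cong : ∀ {z z′ w w′} → z ≈ z′ → w ≈ w′ → z + w * ρ ≈ z′ + w′ * ρ
  val-cong z≈z′ w≈w′ = +-cong z≈z′ (*-cong w≈w′ (≈-refl {ρ}))

  -- The relative norm: the product of a + b √x with its algebraic conjugate a - b √x.
  norm : Code × Code → Code
  norm (a , b) = a ⊗ a ⊕ ⊖ (c ⊗ (b ⊗ b))

  norm-val : ∀ a b → ⟦ norm (a , b) ⟧ ≈ val (a , b) * (⟦ a ⟧ - ⟦ b ⟧ * ρ)
  norm-val a b = ≈-trans
    (≈-trans (⟦⊕⟧ (a ⊗ a) (⊖ (c ⊗ (b ⊗ b)))) (+-cong (⟦⊗⟧ a a)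
      (≈-trans (⟦⊖⟧ (c ⊗ (b ⊗ b))) (neg-cong
        (≈-trans (⟦⊗⟧ c (b ⊗ b)) (*-cong c≈ρ² (⟦⊗⟧ b b)))))))
    (solve 3 (λ a b ρ → a :* a :- ρ :* ρ :* (b :* b) := (a :+ b :* ρ) :* (a :- b :* ρ))
      ≈-refl ⟦ a ⟧ ⟦ b ⟧ ρ)

  -- A value a + b √x vanishes if a and b do, and does not if its norm a² - x b² does not.
  -- When neither test succeeds (x could be a square in A), the question is left open.
  vanishes : ∀ y → Maybe (Dec (val y ≈ 0ℂ))
  vanishes (a , b) with vanishes? a | vanishes? b | vanishes? (norm (a , b))
  ... | just (yes a≈0) | just (yes b≈0) | _ = just (yes
    (≈-trans (val-cong a≈0 b≈0) (solve 1 (λ ρ → con 0ℚ :+ con 0ℚ :* ρ := con 0ℚ) ≈-refl ρ)))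
  ... | _ | _ | just (no norm≉0) = just (no λ y≈0 → norm≉0
    (≈-trans (norm-val a b) (≈-trans
      (*-cong y≈0 (≈-refl {⟦ a ⟧ - ⟦ b ⟧ * ρ})) (zeroˡ (⟦ a ⟧ - ⟦ b ⟧ * ρ)))))
  ... | _ | _ | _ = nothing

  extension : Subring
  extension = record
    { Code = Code × Code
    ; 𝟘    = 𝟘 , 𝟘
    ; 𝟙    = 𝟙 , 𝟘
    ; _⊕_  = λ (a , b) (a′ , b′) → a ⊕ a′ , b ⊕ b′
    ; _⊗_  = λ (a , b) (a′ , b′) → a ⊗ a′ ⊕ c ⊗ (b ⊗ b′) , a ⊗ b′ ⊕ b ⊗ a′
    ; ⊖_   = λ (a , b) → ⊖ a , ⊖ b
    ; _†   = λ (a , b) → a † , b †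
    ; ⟦_⟧  = val
    ; ⟦𝟘⟧  = ≈-trans (val-cong ⟦𝟘⟧ ⟦𝟘⟧) (solve 1 (λ ρ → con 0ℚ :+ con 0ℚ :* ρ := con 0ℚ) ≈-refl ρ)
    ; ⟦𝟙⟧  = ≈-trans (val-cong ⟦𝟙⟧ ⟦𝟘⟧) (solve 1 (λ ρ → con 1ℚ :+ con 0ℚ :* ρ := con 1ℚ) ≈-refl ρ)
    ; ⟦⊕⟧  = λ (a , b) (a′ , b′) → ≈-trans (val-cong (⟦⊕⟧ a a′) (⟦⊕⟧ b b′))
        (solve 5 (λ a b a′ b′ ρ → (a :+ a′) :+ (b :+ b′) :* ρ := (a :+ b :* ρ) :+ (a′ :+ b′ :* ρ))
          ≈-refl ⟦ a ⟧ ⟦ b ⟧ ⟦ a′ ⟧ ⟦ b′ ⟧ ρ)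
    ; ⟦⊗⟧  = λ (a , b) (a′ , b′) → ≈-trans
        (val-cong
          (≈-trans (⟦⊕⟧ (a ⊗ a′) (c ⊗ (b ⊗ b′)))
            (+-cong (⟦⊗⟧ a a′) (≈-trans (⟦⊗⟧ c (b ⊗ b′)) (*-cong c≈ρ² (⟦⊗⟧ b b′)))))
          (≈-trans (⟦⊕⟧ (a ⊗ b′) (b ⊗ a′)) (+-cong (⟦⊗⟧ a b′) (⟦⊗⟧ b a′))))
        (solve 5 (λ a b a′ b′ ρ →
            (a :* a′ :+ ρ :* ρ :* (b :* b′)) :+ (a :* b′ :+ b :* a′) :* ρ
              := (a :+ b :* ρ) :* (a′ :+ b′ :* ρ))
          ≈-refl ⟦ a ⟧ ⟦ b ⟧ ⟦ a′ ⟧ ⟦ b′ ⟧ ρ)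
    ; ⟦⊖⟧  = λ (a , b) → ≈-trans (val-cong (⟦⊖⟧ a) (⟦⊖⟧ b))
        (solve 3 (λ a b ρ → :- a :+ :- b :* ρ := :- (a :+ b :* ρ)) ≈-refl ⟦ a ⟧ ⟦ b ⟧ ρ)
    -- The adjoined root is real, so complex conjugation acts on each coordinate separately.
    ; ⟦†⟧  = λ (a , b) → ≈-trans (val-cong (⟦†⟧ a) (⟦†⟧ b)) (≈-sym
        (≈-trans (conj-+ ⟦ a ⟧ (⟦ b ⟧ * ρ)) (+-cong (≈-refl {conj ⟦ a ⟧})
          (≈-trans (conj-* ⟦ b ⟧ ρ) (*-cong (≈-refl {conj ⟦ b ⟧}) (conj-fromℝ (√ x)))))))
    ; vanishes? = vanishes
    }

  include : ∀ {z} → Exact A z → Exact extension z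
  include {z} (exact a a≈z) = exact (a , 𝟘)
    (≈-trans (val-cong a≈z ⟦𝟘⟧) (solve 2 (λ z ρ → z :+ con 0ℚ :* ρ := z) ≈-refl z ρ))

  root′ : Exact extension ρ
  root′ = exact (𝟘 , 𝟙)
    (≈-trans (val-cong ⟦𝟘⟧ ⟦𝟙⟧) (solve 1 (λ ρ → con 0ℚ :+ con 1ℚ :* ρ := ρ) ≈-refl ρ))

-- The field ℚ(i, √69, s, r)

rational : ∀ q → Exact ℚ[i] (fromℝ (fromℚ q))
rational q = exact (just (q , 0ℚ)) ≈-refl

i-exact : Exact ℚ[i] i
i-exact = exact (just (0ℚ , 1ℚ)) ≈-refl

-- If x > b, then x² ≥ b² > q. The alternative x = 0 has the form of `Root.lower`, where 0 is the
-- default value of the search.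
square-≤⇒≤ : ∀ {x q b} → 0ℚ ℚ.≤ b → q ℚ.< b ℚ.* b → x ≡ 0ℚ ⊎ x ℚ.* x ℚ.≤ q → x ℚ.≤ b
square-≤⇒≤ 0≤b q<b² (inj₁ refl) = 0≤b
square-≤⇒≤ {x} {q} {b} 0≤b q<b² (inj₂ x²≤q) with x ℚ.≤? b
... | yes x≤b = x≤b
... | no  x≰b = contradiction
  (ℚ.≤-<-trans (ℚ.≤-trans (square-mono 0≤b (ℚ.<⇒≤ (ℚ.≰⇒> x≰b))) x²≤q) q<b²) (ℚ.<-irrefl refl)

-- 70 * suc n is the number of search steps in the definition of root for the radicand 69.
0≤C : 0≤ᴿ C
0≤C ε 0<ε = 0 , λ n _ → ℚ.<-≤-trans (ℚ.neg-antimono-< 0<ε) (C-bound (seq √69 n)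
  (square-≤⇒≤ (/-nonNeg 9 1) (from-yes (+ 69 / 1 ℚ.<? + 9 / 1 ℚ.* (+ 9 / 1)))
    (Root.lower (70 ℕ.* ℕ.suc n) (+ 69 / 1) n)))
  where
  open ℚ.≤-Reasoning
  -- The bound 9 comes from 69 < 81 and is good enough: 49 - 5 · 9 = 4.
  C-bound : ∀ y → y ℚ.≤ + 9 / 1 → 0ℚ ℚ.≤ + 1 / 26 ℚ.* (+ 49 / 1 ℚ.- + 5 / 1 ℚ.* y)
  C-bound y y≤9 = *-nonNeg (/-nonNeg 1 26) (begin
    0ℚ                                    ≤⟨ /-nonNeg 4 1 ⟩
    + 49 / 1 ℚ.- + 5 / 1 ℚ.* (+ 9 / 1)    ≤⟨ ℚ.+-monoʳ-≤ (+ 49 / 1) (ℚ.neg-antimono-≤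
                                               (ℚ.*-monoˡ-≤-nonNeg (+ 5 / 1) y≤9)) ⟩
    + 49 / 1 ℚ.- + 5 / 1 ℚ.* y            ∎)

0≤N : 0≤ᴿ N
0≤N ε 0<ε = let M , C>-ε = 0≤C ε 0<ε in M , λ n n≥M →
  ℚ.<-trans (C>-ε n n≥M)
    (subst (ℚ._< 1ℚ ℚ.+ seq C n) (ℚ.+-identityˡ (seq C n))
      (ℚ.+-monoˡ-< (seq C n) (ℚ.positive⁻¹ 1ℚ)))

0≤69 : 0≤ᴿ fromℚ (+ 69 / 1)
0≤69 ε 0<ε = 0 , λ _ _ → ℚ.<-≤-trans (ℚ.neg-antimono-< 0<ε) (/-nonNeg 69 1)

-- First storey of the tower ℚ(i), √69, s, r. Each radicand must have a code one storey below: `C`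
-- needs √69, and `N` = 1 + `C` is carried into the storey of s.
module Adjoin√69 = AdjoinRoot ℚ[i] (fromℚ (+ 69 / 1)) 0≤69 (rational (+ 69 / 1))

C′ : Exact Adjoin√69.extension (fromℝ C)
C′ = q (+ 1 / 26) *ᴿ′ (q (+ 49 / 1) -ᴿ′ q (+ 5 / 1) *ᴿ′ Adjoin√69.root′)
  where
  open Arithmetic Adjoin√69.extension
  q : ∀ p → Exact Adjoin√69.extension (fromℝ (fromℚ p))
  q p = Adjoin√69.include (rational p)

module Adjoin-s = AdjoinRoot Adjoin√69.extension C 0≤C C′

N′ : Exact Adjoin-s.extension (fromℝ N)
N′ = Adjoin-s.include (Adjoin√69.include (rational 1ℚ) +ᴿ′ C′)
  where open Arithmetic Adjoin√69.extension

module Adjoin-r = AdjoinRoot Adjoin-s.extension N 0≤N N′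

𝕂 : Subring
𝕂 = Adjoin-r.extension

open Arithmetic 𝕂

embed : ∀ {z} → Exact ℚ[i] z → Exact 𝕂 z
embed = Adjoin-r.include ∘ Adjoin-s.include ∘ Adjoin√69.include

q′ : ∀ q → Exact 𝕂 (fromℝ (fromℚ q))
q′ q = embed (rational q)

√69′ : Exact 𝕂 (fromℝ √69)
√69′ = Adjoin-r.include (Adjoin-s.include Adjoin√69.root′)

s′ : Exact 𝕂 (fromℝ s)
s′ = Adjoin-r.include Adjoin-s.root′

r′ : Exact 𝕂 (fromℝ r)
r′ = Adjoin-r.root′

i′ : Exact 𝕂 i
i′ = embed i-exact

infix 5 _+i′_
_+i′_ : ∀ {x y} → Exact 𝕂 (fromℝ x) → Exact 𝕂 (fromℝ y) → Exact 𝕂 (x +i y)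
_+i′_ = +i-exact i′

-- Exact coordinates of the vectors

η′ : Exact 𝕂 η
η′ = q′ (+ 5 / 13) +i′ q′ (+ 12 / 13)

ζ′ : Exact 𝕂 ζ
ζ′ = q′ (+ 1 / 65) *ᴿ′ (q′ (+ 14 / 1) +ᴿ′ q′ (+ 6 / 1) *ᴿ′ √69′)
 +i′ q′ (+ 1 / 65) *ᴿ′ (q′ (+ 4 / 1) *ᴿ′ √69′ -ᴿ′ q′ (+ 21 / 1))

-- The cases are listed because `μ j` reduces to an expression only at a concrete index.
μ′ : ∀ j → Exact 𝕂 (μ j)
μ′ 0F = -′ 1′
μ′ 1F = η′
μ′ 2F = 1′
μ′ 3F = -′ η′
μ′ 4F = -′ 1′
μ′ 5F = η′
μ′ 6F = 1′
μ′ 7F = -′ η′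

τ′ : ∀ j → Exact 𝕂 (τ j)
τ′ 0F = 1′
τ′ 1F = ζ′
τ′ 2F = -′ i′
τ′ 3F = -′ (i′ *′ ζ′)
τ′ 4F = -′ 1′
τ′ 5F = -′ ζ′
τ′ 6F = i′
τ′ 7F = i′ *′ ζ′

v′ : ∀ j k → Exact 𝕂 (v j k)
v′ j 0F = 1′
v′ j 1F = s′ *′ μ′ j
v′ j 2F = r′ *′ τ′ j

vectors′ : ∀ u k → Exact 𝕂 (vectors u k)
vectors′ (midpoint j) k = v′ j k
vectors′ (corner j) k = conj′ (cross′ (v′ j) (v′ (next j)) k)
vectors′ a₁ 0F = s′
vectors′ a₁ 1F = 1′
vectors′ a₁ 2F = 0′
vectors′ a₂ 0F = s′
vectors′ a₂ 1F = -′ 1′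
vectors′ a₂ 2F = 0′
vectors′ b₁ 0F = s′
vectors′ b₁ 1F = η′
vectors′ b₁ 2F = 0′
vectors′ b₂ 0F = s′
vectors′ b₂ 1F = -′ η′
vectors′ b₂ 2F = 0′

orthogonal? : ∀ u v → Maybe (Dec (⟨ vectors u , vectors v ⟩ ≈ 0ℂ))
orthogonal? u v = zero? ⟨ vectors′ u , vectors′ v ⟩′

-- Orthogonality and adjacency

open ThreeUniformHypergraph H₂₀ using (_∈_; InCommonEdge)

-- An enumeration in blocks of 8 midpoints, 8 corners and 4 remaining vertices; it transfers
-- equality tests and bounded search from `Fin 20` to `Vertex`.
vertex : Fin 20 → Vertex
vertex = [ midpoint , [ corner , a₁ ∷ a₂ ∷ b₁ ∷ b₂ ∷ [] ]′ ∘ splitAt 8 ]′ ∘ splitAt 8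

index : Vertex → Fin 20
index (midpoint j) = j ↑ˡ 12
index (corner j)   = 8 ↑ʳ (j ↑ˡ 4)
index a₁           = 16 ↑ʳ 0F
index a₂           = 16 ↑ʳ 1F
index b₁           = 16 ↑ʳ 2F
index b₂           = 16 ↑ʳ 3F

vertex-index : ∀ u → vertex (index u) ≡ u
vertex-index (midpoint j) rewrite splitAt-↑ˡ 8 j 12 = refl
vertex-index (corner j)   rewrite splitAt-↑ˡ 8 j 4  = refl
vertex-index a₁           = refl
vertex-index a₂           = refl
vertex-index b₁           = refl
vertex-index b₂           = refl

_≟_ : DecidableEquality Vertex
u ≟ v = map′
  (λ eq → trans (sym (vertex-index u)) (trans (cong vertex eq) (vertex-index v)))
  (cong index) (index u Fin.≟ index v)

all-vertices? : ∀ {P : Vertex → Set} → (∀ u → Dec (P u)) → Dec (∀ u → P u)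
all-vertices? {P} P? = map′
  (λ p u → subst P (vertex-index u) (p (index u))) (_∘ vertex) (all? (P? ∘ vertex))

any-vertex? : ∀ {P : Vertex → Set} → (∀ u → Dec (P u)) → Dec (∃[ u ] P u)
any-vertex? {P} P? = map′ (λ (k , p) → vertex k , p)
  (λ (u , p) → index u , subst P (sym (vertex-index u)) p) (any? (P? ∘ vertex))

any-hyperedge? : ∀ {P : Hyperedge → Set} → (∀ e → Dec (P e)) → Dec (∃[ e ] P e)
any-hyperedge? P? = map′
  (λ where
    (inj₁ (j , p))                → cyclic j , p
    (inj₂ (inj₁ p))               → D₀ , p
    (inj₂ (inj₂ (inj₁ p)))        → D₁ , p
    (inj₂ (inj₂ (inj₂ (inj₁ p)))) → D₂ , p
    (inj₂ (inj₂ (inj₂ (inj₂ p)))) → D₃ , p)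
  (λ where
    (cyclic j , p) → inj₁ (j , p)
    (D₀ , p)       → inj₂ (inj₁ p)
    (D₁ , p)       → inj₂ (inj₂ (inj₁ p))
    (D₂ , p)       → inj₂ (inj₂ (inj₂ (inj₁ p)))
    (D₃ , p)       → inj₂ (inj₂ (inj₂ (inj₂ p))))
  (any? (P? ∘ cyclic) ⊎-dec P? D₀ ⊎-dec P? D₁ ⊎-dec P? D₂ ⊎-dec P? D₃)

-- Every vertex shares a hyperedge with itself, but no representing vector is orthogonal to itself.
-- Excluding the diagonal makes the relation agree with orthogonality on all pairs.
Adjacent : Vertex → Vertex → Set
Adjacent u v = u ≢ v × InCommonEdge u v

adjacent? : ∀ u v → Dec (Adjacent u v)
adjacent? u v = ¬? (u ≟ v) ×-dec any-hyperedge? λ e → u ∈? e ×-dec v ∈? e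
  where
  _∈?_ : ∀ u e → Dec (u ∈ e)
  u ∈? e = any? λ k → edge₂₀ e k ≟ u

-- A finite check on the hypergraph alone. If u and v are adjacent, w = u is a possible choice;
-- nonadjacent pairs need a third vertex.
separating-neighbour : ∀ u v → u ≢ v → ∃[ w ] Adjacent w v × ¬ Adjacent w u
separating-neighbour = from-yes (all-vertices? λ u → all-vertices? λ v →
  ¬? (u ≟ v) →-dec any-vertex? λ w → adjacent? w v ×-dec ¬? (adjacent? w u))

-- Turns agreement of computed booleans back into a logical equivalence. Agreement with a `just`
-- also rules out an inconclusive test.
same-answer : ∀ {P Q : Set} (p? : Maybe (Dec P)) (q? : Dec Q) →
              Maybe.map does p? ≡ just (does q?) → P ⇔ Q
same-answer (just (yes p)) (yes q) _ = mk⇔ (λ _ → q) (λ _ → p)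
same-answer (just (no ¬p)) (no ¬q) _ = mk⇔ (λ p → contradiction p ¬p) (λ q → contradiction q ¬q)
same-answer (just (yes _)) (no _)  ()
same-answer (just (no _))  (yes _) ()
same-answer nothing        _       ()

-- Evaluation over all 400 ordered pairs. In particular, the norm test succeeds for every inner
-- product whose coordinates do not all vanish.
gram-table : ∀ u v → Maybe.map does (orthogonal? u v) ≡ just (does (adjacent? u v))
gram-table = from-yes (all-vertices? λ u → all-vertices? λ v →
  Maybe.≡-dec Bool._≟_ (Maybe.map does (orthogonal? u v)) (just (does (adjacent? u v))))

orthogonal⇔adjacent : ∀ u v → ⟨ vectors u , vectors v ⟩ ≈ 0ℂ ⇔ Adjacent u v
orthogonal⇔adjacent u v = same-answer (orthogonal? u v) (adjacent? u v) (gram-table u v)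

-- Nonzero vectors and distinct rays

⟨⟩-scale : ∀ {d} (w x y : Vector ℂ d) c → (∀ k → y k ≈ c * x k) → ⟨ w , y ⟩ ≈ c * ⟨ w , x ⟩
⟨⟩-scale {ℕ.zero}  w x y c y≈cx = ≈-sym (zeroʳ c)
⟨⟩-scale {ℕ.suc _} w x y c y≈cx = ≈-trans
  (+-cong (*-cong (≈-refl {conj (w 0F)}) (y≈cx 0F))
    (⟨⟩-scale (w ∘ suc) (x ∘ suc) (y ∘ suc) c (y≈cx ∘ suc)))
  -- Only the first argument is conjugated, so `c` leaves the second one unchanged.
  (solve 4 (λ w x c z → w :* (c :* x) :+ c :* z := c :* (w :* x :+ z)) ≈-refl
    (conj (w 0F)) (x 0F) c ⟨ w ∘ suc , x ∘ suc ⟩)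

vectors-nonzero : ∀ u → NonzeroVector (vectors u)
vectors-nonzero u x≋0 = u≢u refl
  where
  ⟨x,x⟩≈0 : ⟨ vectors u , vectors u ⟩ ≈ 0ℂ
  ⟨x,x⟩≈0 = ≈-trans
    -- A zero vector equals 0 times itself, hence is orthogonal to itself.
    (⟨⟩-scale (vectors u) (vectors u) (vectors u) 0ℂ
      (λ k → ≈-trans (equal (x≋0 k)) (≈-sym (zeroˡ (vectors u k)))))
    (zeroˡ ⟨ vectors u , vectors u ⟩)
  u≢u : u ≢ u
  u≢u = proj₁ (to (orthogonal⇔adjacent u u) ⟨x,x⟩≈0)

vectors-distinct-rays : ∀ u v → u ≢ v → ¬ SameRay (vectors u) (vectors v)
vectors-distinct-rays u v u≢v same =
  let
    w , w~v , w≁u = separating-neighbour u v u≢v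
    -- The vector of u lies in its own span with coefficient 1, hence is a multiple of the vector of
    -- v; orthogonality to the vector of w passes from v to u.
    c , u≋cv = to (same (vectors u)) (1ℂ , λ k → ≈⇒≃ (≈-sym (*-identityˡ (vectors u k))))
  in w≁u (to (orthogonal⇔adjacent w u) (≈-trans
    (⟨⟩-scale (vectors w) (vectors v) (vectors u) c (λ k → equal (u≋cv k)))
    (≈-trans (*-cong (≈-refl {c}) (from (orthogonal⇔adjacent w v) w~v)) (zeroʳ c))))

-- Closed form of the corner vectors

conj-real-* : ∀ x z → conj (fromℝ x * z) ≈ fromℝ x * conj z
conj-real-* x z = ≈-trans (conj-* (fromℝ x) z) (*-cong (conj-fromℝ x) (≈-refl {conj z}))

-- Each coordinate of a cross product is a 2×2 minor. Passing in the simplified conjugates of its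
-- entries leaves a polynomial identity in which conj μ and conj τ are variables.
conj-minor : ∀ a b c d {a′ b′ c′ d′} → conj a ≈ a′ → conj b ≈ b′ → conj c ≈ c′ → conj d ≈ d′ →
             conj (a * b - c * d) ≈ a′ * b′ - c′ * d′
conj-minor a b c d a≈ b≈ c≈ d≈ = ≈-trans (conj-+ (a * b) (- (c * d)))
  (+-cong (≈-trans (conj-* a b) (*-cong a≈ b≈))
    (≈-trans (conj-neg (c * d)) (neg-cong (≈-trans (conj-* c d) (*-cong c≈ d≈)))))

corner-formula : ∀ j k → vectors (corner j) k ≈ cornerFormula j k
corner-formula j = λ where
    0F → ≈-trans
      (conj-minor (x 1F) (y 2F) (x 2F) (y 1F)
        (conj-real-* s m) (conj-real-* r t′) (conj-real-* r t) (conj-real-* s m′))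
      (solve 6 (λ s r m t m′ t′ →
          (s :* m) :* (r :* t′) :- (r :* t) :* (s :* m′) := s :* r :* (m :* t′ :- t :* m′))
        ≈-refl (fromℝ s) (fromℝ r) (conj m) (conj t) (conj m′) (conj t′))
    1F → ≈-trans
      (conj-minor (x 2F) (y 0F) (x 0F) (y 2F) (conj-real-* r t) conj-1 conj-1 (conj-real-* r t′))
      (solve 3 (λ r t t′ → (r :* t) :* con 1ℚ :- con 1ℚ :* (r :* t′) := r :* (t :- t′))
        ≈-refl (fromℝ r) (conj t) (conj t′))
    2F → ≈-trans
      (conj-minor (x 0F) (y 1F) (x 1F) (y 0F) conj-1 (conj-real-* s m′) (conj-real-* s m) conj-1)
      (solve 3 (λ s m m′ → con 1ℚ :* (s :* m′) :- (s :* m) :* con 1ℚ := s :* (m′ :- m))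
        ≈-refl (fromℝ s) (conj m) (conj m′))
  where
  x y : Vector ℂ 3
  x = v j
  y = v (next j)
  m m′ t t′ : ℂ
  m  = μ j
  m′ = μ (next j)
  t  = τ j
  t′ = τ (next j)
  conj-1 : conj 1ℂ ≈ 1ℂ
  conj-1 = conj-fromℝ (fromℚ 1ℚ)

theorem4 : IsFaithfulOrthogonalRepresentation H₂₀ vectors × ((j : Fin 8) → vectors (corner j) ≋ cornerFormula j)
theorem4 = record
  { nonzero       = vectors-nonzero
  ; distinct-rays = vectors-distinct-rays
  -- The table speaks of `Adjacent`, which contains u ≢ v: one direction projects it away, the other
  -- supplies it.
  ; orthogonality = λ u v u≢v → mk⇔
      (λ u⊥v → proj₂ (to (orthogonal⇔adjacent u v) (equal u⊥v)))
      (λ common → ≈⇒≃ (from (orthogonal⇔adjacent u v) (u≢v , common)))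
  } , λ j k → ≈⇒≃ (corner-formula j k)
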